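{- Let $G_1$ and $G_2$ be vertex-disjoint graphs on $n_1$ and $n_2$ vertices respectively. Then, as identities of rational functions in $x$: (a) $$\begin{aligned} f_{Q(G_1\underset{=}{\vee}G_2)}(x)&=\det\big((x-n_1)I_{n_2}-Q(G_2)\big)\,\det\big((x-n_1+1)I_{n_1}+D(G_1)\big)\\ &\cdot\det\Big((x-n_1-n_2+1)I_{n_1}-Q(G_1)+D(G_1)-A(\overline{G_1})\big((x-n_1+1)I_{n_1}+D(G_1)\big)^{ -1}A(\overline{G_1})\Big)\\ &\cdot\Big[1-\Gamma_{Q(G_2)}(x-n_1)\,\Gamma_{Q(G_1)-D(G_1)+A(\overline{G_1})((x-n_1+1)I_{n_1}+D(G_1))^{ -1}A(\overline{G_1})}(x-n_1-n_2+1)\Big].\end{aligned}$$ (b) $$\begin{aligned} f_{Q(G_1\veebar G_2)}(x)&=\det\big((x-n_1)I_{n_2}-Q(G_2)\big)\,\det\big(xI_{n_1}-D(G_1)\big)\\ &\cdot\det\Big((x-n_2)I_{n_1}-Q(G_1)-D(G_1)-A(G_1)\big(xI_{n_1}-D(G_1)\big)^{ -1}A(G_1)\Big)\\ &\cdot\Big[1-\Gamma_{Q(G_2)}(x-n_1)\,\Gamma_{Q(G_1)+D(G_1)+A(G_1)(xI_{n_1}-D(G_1))^{ -1}A(G_1)}(x-n_2)\Big].\end{aligned}$$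
   Context: Graphs are finite, undirected and simple. $A(G)$ is the adjacency matrix, $D(G)$ the diagonal matrix of vertex degrees, $Q(G)=D(G)+A(G)$ the signless Laplacian matrix, and $\overline{G}$ the complement of $G$. For an $n\times n$ matrix $M$, $f_M(x)=\det(xI_n-M)$, and the coronal of $M$ is $\Gamma_M(y)=\mathbf 1_n^T(yI_n-M)^{ -1}\mathbf 1_n$, where $\mathbf 1_n$ is the all-ones column. When the entries of $M$ depend on $x$, $\Gamma_M(x-c)$ means $\mathbf 1_n^T((x-c)I_n-M)^{ -1}\mathbf 1_n$ with that same $x$. Let $V(G_1)=\{u_1,\dots,u_{n_1}\}$. The join $G_1\vee G_2$ is the disjoint union of $G_1$ and $G_2$ together with all edges between $V(G_1)$ and $V(G_2)$. The NS (Neighbors Splitting) join $G_1\veebar G_2$ is obtained from $G_1\vee G_2$ by adding new vertices $u_1',\dots,u_{n_1}'$ and joining $u_i'$ to $u_j$ if and only if $u_iu_j\in E(G_1)$. The NNS (Non Neighbors Splitting) join $G_1\underset{=}{\vee}G_2$ is obtained from $G_1\vee G_2$ by adding new vertices $u_1',\dots,u_{n_1}'$ and joining $u_i'$ to $u_j$ if and only if $i\ne j$ and $u_iu_j\notin E(G_1)$. -}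

module Defs where

open import Algebra.Bundles.Raw using (RawRing)
import Algebra.Definitions.RawMonoid as RawMonoidOps
import Algebra.Definitions.RawSemiring as RawSemiringOps
open import Data.Bool.Base using (if_then_else_)
open import Data.Empty using (⊥)
open import Data.Fin.Base using (Fin; zero; suc; toℕ; splitAt; punchIn)
import Data.Fin.Properties as Fin
open import Data.Integer.Base as ℤ using (ℤ; 0ℤ; 1ℤ)
import Data.Integer.Properties as ℤ
open import Data.List.Base using (List; []; _∷_; map)
open import Data.Nat.Base using (ℕ; zero; suc; _+_)
open import Data.Product.Base using (_×_; _,_)
open import Data.Sum.Base using (_⊎_; inj₁; inj₂; map₁)
open import Data.Unit.Base using (⊤; tt)
open import Data.Vec.Base using (count; allFin)
open import Function.Base using (_∘_)
open import Level using (0ℓ; _⊔_)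
open import Relation.Binary.Core using (Rel)
open import Relation.Binary.Definitions using (Decidable; Symmetric; Irreflexive)
open import Relation.Binary.PropositionalEquality
  using (_≡_; _≢_; refl; sym; trans; cong)
open import Relation.Nullary using (¬_; yes; no; does; contradiction)
open import Relation.Nullary.Decidable using (¬?; _×-dec_)

------------------------------------------------------------------------
-- Finite simple graphs

record Graph (V : Set) : Set₁ where
  field
    E      : Rel V 0ℓ
    E?     : Decidable E
    E-sym  : Symmetric E
    E-irr  : Irreflexive _≡_ E

open Graph

complement : ∀ {n} → Graph (Fin n) → Graph (Fin n)
complement G .E i j = i ≢ j × ¬ E G i j
complement G .E? i j = ¬? (i Fin.≟ j) ×-dec ¬? (E? G i j)
complement G .E-sym (i≢j , ¬e) = i≢j ∘ sym , ¬e ∘ E-sym G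
complement G .E-irr i≡j (i≢j , _) = i≢j i≡j

-- The disjoint union of vertex sets is _⊎_, so the two graphs of a join are
-- automatically vertex-disjoint.
_∨_ : ∀ {V W} → Graph V → Graph W → Graph (V ⊎ W)
_∨_ {V} {W} G H = record { E = R ; E? = R? ; E-sym = λ {a} {b} → R-sym a b ; E-irr = R-irr }
  where
  R : Rel (V ⊎ W) 0ℓ
  R (inj₁ a) (inj₁ b) = E G a b
  R (inj₁ _) (inj₂ _) = ⊤
  R (inj₂ _) (inj₁ _) = ⊤
  R (inj₂ a) (inj₂ b) = E H a b

  R? : Decidable R
  R? (inj₁ a) (inj₁ b) = E? G a b
  R? (inj₁ _) (inj₂ _) = yes tt
  R? (inj₂ _) (inj₁ _) = yes tt
  R? (inj₂ a) (inj₂ b) = E? H a b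

  R-sym : ∀ a b → R a b → R b a
  R-sym (inj₁ _) (inj₁ _) e = E-sym G e
  R-sym (inj₁ _) (inj₂ _) e = tt
  R-sym (inj₂ _) (inj₁ _) e = tt
  R-sym (inj₂ _) (inj₂ _) e = E-sym H e

  R-irr : Irreflexive _≡_ R
  R-irr {inj₁ _} refl e = E-irr G refl e
  R-irr {inj₂ _} refl e = E-irr H refl e

-- G ∨ H together with a copy u′ = inj₂ u of every vertex u of G, where u′ is
-- joined to the vertices v of G with S u v and to nothing else.
splittingJoin : ∀ {V W} → Graph V → Graph W → {S : Rel V 0ℓ} → Decidable S →
                Graph ((V ⊎ W) ⊎ V)
splittingJoin {V} {W} G H {S} S? =
  record { E = R ; E? = R? ; E-sym = λ {a} {b} → R-sym a b ; E-irr = R-irr }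
  where
  R : Rel ((V ⊎ W) ⊎ V) 0ℓ
  R (inj₁ a)        (inj₁ b)        = E (G ∨ H) a b
  R (inj₁ (inj₁ v)) (inj₂ u)        = S u v
  R (inj₁ (inj₂ _)) (inj₂ _)        = ⊥
  R (inj₂ u)        (inj₁ (inj₁ v)) = S u v
  R (inj₂ _)        (inj₁ (inj₂ _)) = ⊥
  R (inj₂ _)        (inj₂ _)        = ⊥

  R? : Decidable R
  R? (inj₁ a)        (inj₁ b)        = E? (G ∨ H) a b
  R? (inj₁ (inj₁ v)) (inj₂ u)        = S? u v
  R? (inj₁ (inj₂ _)) (inj₂ _)        = no λ ()
  R? (inj₂ u)        (inj₁ (inj₁ v)) = S? u v
  R? (inj₂ _)        (inj₁ (inj₂ _)) = no λ ()
  R? (inj₂ _)        (inj₂ _)        = no λ ()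

  R-sym : ∀ a b → R a b → R b a
  R-sym (inj₁ a)        (inj₁ b)        e = E-sym (G ∨ H) {a} {b} e
  R-sym (inj₁ (inj₁ _)) (inj₂ _)        e = e
  R-sym (inj₂ _)        (inj₁ (inj₁ _)) e = e

  R-irr : Irreflexive _≡_ R
  R-irr {inj₁ a} refl e = E-irr (G ∨ H) {a} refl e

pullback : ∀ {V W : Set} → (V → W) → Graph W → Graph V
pullback f G .E a b = E G (f a) (f b)
pullback f G .E? a b = E? G (f a) (f b)
pullback f G .E-sym = E-sym G
pullback f G .E-irr refl = E-irr G refl

-- Vertices in the order u₁ … , v₁ … , u₁′ … ; this map is a bijection.
vertex : ∀ n₁ n₂ → Fin (n₁ + n₂ + n₁) → (Fin n₁ ⊎ Fin n₂) ⊎ Fin n₁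
vertex n₁ n₂ = map₁ (splitAt n₁) ∘ splitAt (n₁ + n₂)

NSJoin : ∀ {n₁ n₂} → Graph (Fin n₁) → Graph (Fin n₂) → Graph (Fin (n₁ + n₂ + n₁))
NSJoin {n₁} {n₂} G₁ G₂ = pullback (vertex n₁ n₂) (splittingJoin G₁ G₂ (E? G₁))

NNSJoin : ∀ {n₁ n₂} → Graph (Fin n₁) → Graph (Fin n₂) → Graph (Fin (n₁ + n₂ + n₁))
NNSJoin {n₁} {n₂} G₁ G₂ = pullback (vertex n₁ n₂)
  (splittingJoin G₁ G₂ (λ i j → ¬? (i Fin.≟ j) ×-dec ¬? (E? G₁ i j)))

degree : ∀ {n} → Graph (Fin n) → Fin n → ℕ
degree {n} G i = count (E? G i) (allFin n)

------------------------------------------------------------------------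
-- Matrices

module Matrices {c ℓ} (R : RawRing c ℓ) where
  open RawRing R using (Carrier; _≈_; _*_; -_; 0#; 1#) renaming (_+_ to _+ᴿ_)
  open RawMonoidOps (RawRing.+-rawMonoid R) using (sum) renaming (_×_ to _×ᴿ_)
  open RawSemiringOps (RawRing.rawSemiring R) using (_^_)

  infix  4 _≋_
  infixl 6 _⊞_ _⊟_
  infixl 7 _⊗_
  infixr 8 _•_

  Matrix : ℕ → ℕ → Set c
  Matrix m n = Fin m → Fin n → Carrier

  -- The image of a natural number in R.
  ι : ℕ → Carrier
  ι n = n ×ᴿ 1#

  _≋_ : ∀ {m n} → Matrix m n → Matrix m n → Set ℓ
  M ≋ N = ∀ i j → M i j ≈ N i j

  _⊞_ _⊟_ : ∀ {m n} → Matrix m n → Matrix m n → Matrix m n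
  (M ⊞ N) i j = M i j +ᴿ N i j
  (M ⊟ N) i j = M i j +ᴿ - N i j

  _•_ : ∀ {m n} → Carrier → Matrix m n → Matrix m n
  (a • M) i j = a * M i j

  _⊗_ : ∀ {m n p} → Matrix m n → Matrix n p → Matrix m p
  (M ⊗ N) i k = sum λ j → M i j * N j k

  _ᵀ : ∀ {m n} → Matrix m n → Matrix n m
  (M ᵀ) i j = M j i

  diag : ∀ {n} → (Fin n → Carrier) → Matrix n n
  diag d i j = if does (i Fin.≟ j) then d i else 0#

  I : ∀ {n} → Matrix n n
  I = diag λ _ → 1#

  𝟏 : ∀ {n} → Matrix n 1
  𝟏 _ _ = 1#

  -- Laplace expansion along the first row; the empty matrix has determinant 1.
  det : ∀ {n} → Matrix n n → Carrier
  det {zero}  M = 1#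
  det {suc n} M = sum λ j →
    (- 1#) ^ toℕ j * (M zero j * det λ i k → M (suc i) (punchIn j k))

  record Invertible {n} (M : Matrix n n) : Set (c ⊔ ℓ) where
    field
      _⁻¹     : Matrix n n
      inverseˡ : _⁻¹ ⊗ M ≋ I
      inverseʳ : M ⊗ _⁻¹ ≋ I

  open Invertible public using (_⁻¹)

  -- The coronal Γ_M(y) makes sense when y I − M is invertible; its value does
  -- not depend on the invertibility proof, inverses being unique up to ≋.
  Γ : ∀ {n} (M : Matrix n n) (y : Carrier) → Invertible (y • I ⊟ M) → Carrier
  Γ M y inv = (𝟏 ᵀ ⊗ inv ⁻¹ ⊗ 𝟏) zero zero

  A D Q : ∀ {n} → Graph (Fin n) → Matrix n n
  A G i j = if does (E? G i j) then 1# else 0#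
  D G = diag λ i → ι (degree G i)
  Q G = D G ⊞ A G

------------------------------------------------------------------------
-- Polynomials over ℤ: coefficient lists, constant term first, identified
-- when they differ only by trailing zeros

Poly : Set
Poly = List ℤ

coeff : Poly → ℕ → ℤ
coeff []      _       = 0ℤ
coeff (a ∷ _) zero    = a
coeff (_ ∷ p) (suc k) = coeff p k

infix  4 _≈ₚ_
infixl 6 _+ₚ_
infixl 7 _*ₚ_

_≈ₚ_ : Rel Poly 0ℓ
p ≈ₚ q = ∀ k → coeff p k ≡ coeff q k

_+ₚ_ : Poly → Poly → Poly
[]      +ₚ q       = q
p       +ₚ []      = p
(a ∷ p) +ₚ (b ∷ q) = a ℤ.+ b ∷ p +ₚ q

-ₚ_ : Poly → Poly
-ₚ_ = map λ a → ℤ.- a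

_*ₚ_ : Poly → Poly → Poly
[]      *ₚ q = []
(a ∷ p) *ₚ q = map (a ℤ.*_) q +ₚ (0ℤ ∷ p *ₚ q)

NonZeroₚ : Poly → Set
NonZeroₚ p = ¬ p ≈ₚ []

coeff-+ₚ : ∀ p q k → coeff (p +ₚ q) k ≡ coeff p k ℤ.+ coeff q k
coeff-+ₚ []      q       k       = sym (ℤ.+-identityˡ _)
coeff-+ₚ (a ∷ p) []      k       = sym (ℤ.+-identityʳ _)
coeff-+ₚ (a ∷ p) (b ∷ q) zero    = refl
coeff-+ₚ (a ∷ p) (b ∷ q) (suc k) = coeff-+ₚ p q k

coeff-map* : ∀ a p k → coeff (map (a ℤ.*_) p) k ≡ a ℤ.* coeff p k
coeff-map* a []      k       = sym (ℤ.*-zeroʳ a)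
coeff-map* a (b ∷ p) zero    = refl
coeff-map* a (b ∷ p) (suc k) = coeff-map* a p k

coeff-∷* : ∀ a p q k →
           coeff ((a ∷ p) *ₚ q) k ≡ a ℤ.* coeff q k ℤ.+ coeff (0ℤ ∷ p *ₚ q) k
coeff-∷* a p q k = trans (coeff-+ₚ (map (a ℤ.*_) q) (0ℤ ∷ p *ₚ q) k)
                         (cong (ℤ._+ coeff (0ℤ ∷ p *ₚ q) k) (coeff-map* a q k))

*ₚ-0∷ : ∀ p q → p *ₚ (0ℤ ∷ q) ≈ₚ 0ℤ ∷ p *ₚ q
*ₚ-0∷ []      q zero          = refl
*ₚ-0∷ []      q (suc k)       = refl
*ₚ-0∷ (a ∷ p) q zero          =
  trans (coeff-∷* a p (0ℤ ∷ q) 0) (cong (ℤ._+ 0ℤ) (ℤ.*-zeroʳ a))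
*ₚ-0∷ (a ∷ p) q (suc k)       =
  trans (coeff-∷* a p (0ℤ ∷ q) (suc k))
 (trans (cong (λ c → a ℤ.* coeff q k ℤ.+ c) (*ₚ-0∷ p q k))
        (sym (coeff-∷* a p q k)))

*ₚ-nonZero : ∀ p q → NonZeroₚ p → NonZeroₚ q → NonZeroₚ (p *ₚ q)
*ₚ-nonZero p q p≉0 q≉0 pq≈0 = q≉0 (cancel p q p≉0 pq≈0)
  where
  cancel : ∀ p q → NonZeroₚ p → p *ₚ q ≈ₚ [] → q ≈ₚ []
  cancel []      q p≉0 _ = contradiction (λ _ → refl) p≉0
  cancel (a ∷ p) q p≉0 pq≈0 with a ℤ.≟ 0ℤ
  ... | yes refl = cancel p q
    (λ p≈0 → p≉0 λ { zero → refl ; (suc k) → p≈0 k })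
    (λ k → trans (sym (ℤ.+-identityˡ _))
          (trans (cong (ℤ._+ coeff (p *ₚ q) k) (sym (ℤ.*-zeroˡ (coeff q (suc k)))))
          (trans (sym (coeff-∷* 0ℤ p q (suc k))) (pq≈0 (suc k)))))
  ... | no a≢0 = go q pq≈0
    where
    go : ∀ q → (a ∷ p) *ₚ q ≈ₚ [] → q ≈ₚ []
    go []      _ _ = refl
    go (b ∷ q) h with ℤ.i*j≡0⇒i≡0∨j≡0 a
                        (trans (sym (ℤ.+-identityʳ _)) (trans (sym (coeff-∷* a p (b ∷ q) 0)) (h 0)))
    ... | inj₁ a≡0  = contradiction a≡0 a≢0
    ... | inj₂ refl = λ
      { zero    → refl
      ; (suc k) → go q (λ j → trans (sym (*ₚ-0∷ (a ∷ p) q (suc j))) (h (suc j))) k }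

------------------------------------------------------------------------
-- Rational functions: the fraction field of ℤ[x], which is ℚ(x)

record RatFun : Set where
  constructor _/_⟨_⟩
  field
    num   : Poly
    den   : Poly
    den≉0 : NonZeroₚ den

open RatFun

fromPoly : Poly → RatFun
fromPoly p = p / (1ℤ ∷ []) ⟨ (λ h → contradiction (h 0) λ ()) ⟩

ℚ⟨x⟩ : RawRing 0ℓ 0ℓ
ℚ⟨x⟩ = record
  { Carrier = RatFun
  ; _≈_ = λ f g → num f *ₚ den g ≈ₚ num g *ₚ den f
  ; _+_ = λ f g → (num f *ₚ den g +ₚ num g *ₚ den f)
                  / (den f *ₚ den g) ⟨ *ₚ-nonZero (den f) (den g) (den≉0 f) (den≉0 g) ⟩
  ; _*_ = λ f g → (num f *ₚ num g)
                  / (den f *ₚ den g) ⟨ *ₚ-nonZero (den f) (den g) (den≉0 f) (den≉0 g) ⟩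
  ; -_  = λ f → (-ₚ num f) / den f ⟨ den≉0 f ⟩
  ; 0#  = fromPoly []
  ; 1#  = fromPoly (1ℤ ∷ [])
  }

x : RatFun
x = fromPoly (0ℤ ∷ 1ℤ ∷ [])

open RawRing ℚ⟨x⟩ public using (_≈_; _*_; -_; 1#) renaming (_+_ to _⊕_)
open Matrices ℚ⟨x⟩ public

infixl 6 _⊝_
_⊝_ : RatFun → RatFun → RatFun
f ⊝ g = f ⊕ - g

-- f_M(x) = det (x I − M) at the indeterminate x.
charPoly : ∀ {n} → Matrix n n → RatFun
charPoly M = det (x • I ⊟ M)

{-# OPTIONS --safe #-}

-- Ordering the vertices as u, v, u′, the matrix x I − Q of a splitting join has diagonal blocks B, Y, X,
-- where X is diagonal, the (u, v) blocks are − J (J all ones) and the (u, u′) blocks are − C, with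
-- C = A(G₁) for the NS join and C = A(complement of G₁) for the NNS join.  The Schur complement of X replaces B by
-- Z = B − C X⁻¹ C, that of Y then replaces Z by Z − Γ J with Γ the sum of the entries of Y⁻¹, and the matrix
-- determinant lemma evaluates det (Z − Γ J).  Y and Z are invertible because their entries are
-- x δᵢⱼ + O(1) at infinity, so that their determinants are xⁿ + lower powers of x, hence non-zero;
-- as both are symmetric, the right inverse adj / det is two-sided.
module Submission where

-- The determinant is given by expansion along the first row, and this shapes the algebra: all
-- determinant facts are derived from rows. Linearity and alternation yield row operations and the
-- adjugate, and the block formulas are inductions over the upper rows. All of it holds over an
-- arbitrary commutative ring, with an arbitrary element `y` in the place of x; rational functions
-- enter only to make X, Y and Z invertible.
--
-- The delicate matrix is Z, because the entries of C X⁻¹ C are themselves rational functions. Since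
-- X is diagonal, its inverse is explicit and its entries are O(1/x), so that C X⁻¹ C is a bounded
-- perturbation and Z can be treated like Y. Leading coefficients are measured against monic
-- denominators: they stay integers, and the leading coefficient of the determinant becomes the
-- determinant of an integer matrix, namely of the identity.

open import Algebra.Bundles using (CommutativeRing)
open import Algebra.Bundles.Raw using (RawRing)
import Algebra.Solver.Ring
open import Algebra.Solver.Ring.AlmostCommutativeRing using (_-Raw-AlmostCommutative⟶_; fromCommutativeRing)
import Algebra.Solver.Ring.NaturalCoefficients.Default
open import Data.Bool.Base using (true; false; if_then_else_)
open import Data.Fin.Base using (Fin; zero; suc; toℕ; splitAt; punchIn; pinch; _↑ˡ_; _↑ʳ_)
import Data.Fin.Properties as Fin
open import Data.Integer.Base as ℤ using (ℤ; 0ℤ; 1ℤ)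
import Data.Integer.Properties as ℤ
open import Data.Integer.Solver using (module +-*-Solver)
open import Data.List.Base using ([]; _∷_; map)
open import Data.Maybe.Base using (Maybe; just; nothing)
open import Data.Nat.Base as ℕ using (ℕ; zero; suc; s≤s; z≤n)
import Data.Nat.Properties as ℕ
open import Data.Product using (Σ-syntax; ∃-syntax; _×_; _,_; proj₂)
open import Data.Sum.Base using (_⊎_; inj₁; inj₂; [_,_]′; map₁)
open import Data.Vec.Base using (count; tabulate)
open import Data.Vec.Functional using (updateAt)
open import Data.Vec.Functional.Properties using (updateAt-updates; updateAt-minimal)
open import Function.Base using (_∘_; const; id)
open import Level using (0ℓ)
open import Relation.Binary.PropositionalEquality as ≡ using (_≡_; _≢_)
open import Relation.Nullary using (yes; no; does; contradiction)
open import Relation.Unary using (Pred; Decidable)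
open import Defs using
  (module Matrices; Graph; complement; splittingJoin; pullback; vertex; degree; NSJoin; NNSJoin)

-- Coefficients for the ring solver: the pair (m , n) stands for the integer m - n.  With
-- decidable coefficients the solver can cancel x against - x in an arbitrary commutative ring.
differences : RawRing 0ℓ 0ℓ
differences = record
  { Carrier = ℕ × ℕ
  ; _≈_ = _≡_
  ; _+_ = λ (a , b) (c , d) → a ℕ.+ c , b ℕ.+ d
  ; _*_ = λ (a , b) (c , d) → a ℕ.* c ℕ.+ b ℕ.* d , a ℕ.* d ℕ.+ b ℕ.* c
  ; -_  = λ (a , b) → b , a
  ; 0#  = 0 , 0
  ; 1#  = 1 , 0
  }

module IntegerRingSolver {c ℓ} (R : CommutativeRing c ℓ) where

  open CommutativeRing R hiding (zero)
  open import Algebra.Properties.Ring ring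
    using (-0#≈0#; -‿involutive; -‿+-comm; -‿distribˡ-*; -‿distribʳ-*; x∙y⁻¹≈ε⇒x≈y)
  open import Algebra.Properties.CommutativeSemigroup +-commutativeSemigroup using (interchange)
  open import Algebra.Properties.Semiring.Mult semiring
    using (×-homo-+; ×1-homo-*; ×-congˡ) renaming (_×_ to _×ᴿ_)
  open import Relation.Binary.Reasoning.Setoid setoid

  private
    open module S = Algebra.Solver.Ring.NaturalCoefficients.Default commutativeSemiring
      using (_:*_; _:+_; _:=_)

    ι : ℕ → Carrier
    ι n = n ×ᴿ 1#

    ⟦_⟧ : ℕ × ℕ → Carrier
    ⟦ a , b ⟧ = ι a + - ι b

    ⟦⟧-+ : ∀ a b c d → ι (a ℕ.+ c) + - ι (b ℕ.+ d) ≈ (ι a + - ι b) + (ι c + - ι d)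
    ⟦⟧-+ a b c d = begin
      ι (a ℕ.+ c) + - ι (b ℕ.+ d)       ≈⟨ +-cong (×-homo-+ 1# a c) (-‿cong (×-homo-+ 1# b d)) ⟩
      ι a + ι c + - (ι b + ι d)         ≈⟨ +-congˡ (-‿+-comm (ι b) (ι d)) ⟨
      ι a + ι c + (- ι b + - ι d)       ≈⟨ interchange _ _ _ _ ⟩
      (ι a + - ι b) + (ι c + - ι d)     ∎

    ι-*-+ : ∀ a c b d → ι (a ℕ.* c ℕ.+ b ℕ.* d) ≈ ι a * ι c + ι b * ι d
    ι-*-+ a c b d = trans (×-homo-+ 1# (a ℕ.* c) (b ℕ.* d)) (+-cong (×1-homo-* a c) (×1-homo-* b d))

    ⟦⟧-* : ∀ a b c d → ι (a ℕ.* c ℕ.+ b ℕ.* d) + - ι (a ℕ.* d ℕ.+ b ℕ.* c) ≈ (ι a + - ι b) * (ι c + - ι d)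
    ⟦⟧-* a b c d = begin
      ι (a ℕ.* c ℕ.+ b ℕ.* d) + - ι (a ℕ.* d ℕ.+ b ℕ.* c)
        ≈⟨ +-cong (ι-*-+ a c b d) (-‿cong (ι-*-+ a d b c)) ⟩
      ι a * ι c + ι b * ι d + - (ι a * ι d + ι b * ι c)
        ≈⟨ +-congˡ (-‿+-comm _ _) ⟨
      ι a * ι c + ι b * ι d + (- (ι a * ι d) + - (ι b * ι c))
        ≈⟨ +-cong (+-congˡ (trans (sym (-‿involutive _)) (trans (-‿cong (-‿distribˡ-* _ _)) (-‿distribʳ-* _ _))))
                  (+-cong (-‿distribʳ-* _ _) (-‿distribˡ-* _ _)) ⟩
      ι a * ι c + - ι b * - ι d + (ι a * - ι d + - ι b * ι c)
        ≈⟨ S.solve 4 (λ a b c d → a :* c :+ b :* d :+ (a :* d :+ b :* c) := (a :+ b) :* (c :+ d))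
             refl (ι a) (- ι b) (ι c) (- ι d) ⟩
      (ι a + - ι b) * (ι c + - ι d) ∎

    ⟦⟧-neg : ∀ a b → ι b + - ι a ≈ - (ι a + - ι b)
    ⟦⟧-neg a b = begin
      ι b + - ι a       ≈⟨ +-comm _ _ ⟩
      - ι a + ι b       ≈⟨ +-congˡ (-‿involutive _) ⟨
      - ι a + - - ι b   ≈⟨ -‿+-comm _ _ ⟩
      - (ι a + - ι b)   ∎

    -- Pairs are never normalised, so different pairs may stand for the same integer. Cross-addition
    -- is the decidable test for that, and this is its soundness.
    ⟦⟧-≈ : ∀ a b c d → a ℕ.+ d ≡ b ℕ.+ c → ⟦ a , b ⟧ ≈ ⟦ c , d ⟧
    ⟦⟧-≈ a b c d eq = x∙y⁻¹≈ε⇒x≈y _ _ (begin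
      ⟦ a , b ⟧ + - ⟦ c , d ⟧       ≈⟨ +-congˡ (⟦⟧-neg c d) ⟨
      ⟦ a , b ⟧ + ⟦ d , c ⟧         ≈⟨ ⟦⟧-+ a b d c ⟨
      ι (a ℕ.+ d) + - ι (b ℕ.+ c)   ≈⟨ +-congʳ (×-congˡ eq) ⟩
      ι (b ℕ.+ c) + - ι (b ℕ.+ c)   ≈⟨ -‿inverseʳ _ ⟩
      0#                            ∎)

    morphism : differences -Raw-AlmostCommutative⟶ fromCommutativeRing R
    morphism = record
      { ⟦_⟧    = ⟦_⟧
      ; +-homo = λ (a , b) (c , d) → ⟦⟧-+ a b c d
      ; *-homo = λ (a , b) (c , d) → ⟦⟧-* a b c d
      ; -‿homo = λ (a , b) → ⟦⟧-neg a b
      ; 0-homo = -‿inverseʳ 0#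
      ; 1-homo = trans (+-cong (+-identityʳ 1#) -0#≈0#) (+-identityʳ 1#)
      }

    _≟_ : ∀ p q → Maybe (⟦ p ⟧ ≈ ⟦ q ⟧)
    (a , b) ≟ (c , d) with (a ℕ.+ d) ℕ.≟ (b ℕ.+ c)
    ... | yes eq = just (⟦⟧-≈ a b c d eq)
    ... | no  _  = nothing

  open Algebra.Solver.Ring differences (fromCommutativeRing R) morphism _≟_ public
    using (solve; _:+_; _:*_; _:-_; :-_; _:=_)

-- Determinants

-- The pairs (`j` , `k`) and (`punchIn j k` , `pinch k j`) delete the same two columns in opposite
-- orders: once column `punchIn j k` is gone, column `j` has the position `pinch k j`. Hence both
-- deletions leave the same columns.
punchIn-comm : ∀ {n} (j : Fin (suc (suc n))) (k : Fin (suc n)) (l : Fin n) →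
  punchIn j (punchIn k l) ≡ punchIn (punchIn j k) (punchIn (pinch k j) l)
punchIn-comm zero    _       _       = ≡.refl
punchIn-comm (suc j) zero    _       = ≡.refl
punchIn-comm (suc j) (suc k) zero    = ≡.refl
punchIn-comm (suc j) (suc k) (suc l) = ≡.cong suc (punchIn-comm j k l)

punchIn-punchIn-pinch : ∀ {n} (j : Fin (suc n)) (k : Fin n) → punchIn (punchIn j k) (pinch k j) ≡ j
punchIn-punchIn-pinch zero    zero    = ≡.refl
punchIn-punchIn-pinch zero    (suc k) = ≡.refl
punchIn-punchIn-pinch (suc j) zero    = ≡.refl
punchIn-punchIn-pinch (suc j) (suc k) = ≡.cong suc (punchIn-punchIn-pinch j k)

punchIn-↑ˡ-↑ˡ : ∀ {m} n (j : Fin (suc m)) (i : Fin m) → punchIn (j ↑ˡ n) (i ↑ˡ n) ≡ punchIn j i ↑ˡ n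
punchIn-↑ˡ-↑ˡ n zero    i       = ≡.refl
punchIn-↑ˡ-↑ˡ n (suc j) zero    = ≡.refl
punchIn-↑ˡ-↑ˡ n (suc j) (suc i) = ≡.cong suc (punchIn-↑ˡ-↑ˡ n j i)

punchIn-↑ˡ-↑ʳ : ∀ {m n} (j : Fin (suc m)) (i : Fin n) → punchIn (j ↑ˡ n) (m ↑ʳ i) ≡ suc m ↑ʳ i
punchIn-↑ˡ-↑ʳ zero            i = ≡.refl
punchIn-↑ˡ-↑ʳ {suc m} (suc j) i = ≡.cong suc (punchIn-↑ˡ-↑ʳ j i)

↑-elim : ∀ {ℓ} m {n} (P : Fin (m ℕ.+ n) → Set ℓ) →
  (∀ i → P (i ↑ˡ n)) → (∀ j → P (m ↑ʳ j)) → ∀ i → P i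
↑-elim m {n} P l r i with splitAt m i in eq
... | inj₁ j = ≡.subst P (Fin.splitAt⁻¹-↑ˡ eq) (l j)
... | inj₂ j = ≡.subst P (Fin.splitAt⁻¹-↑ʳ eq) (r j)

module Determinants {c ℓ} (R : CommutativeRing c ℓ) where

  open CommutativeRing R hiding (zero) renaming (rawRing to raw)
  open Matrices raw
  open import Algebra.Properties.Ring ring
    using (-1*x≈-x; -‿distribˡ-*; -‿involutive)
  open import Algebra.Properties.Semiring.Sum semiring
    using (sum; sum-cong-≋; ∑-distrib-+; *-distribˡ-sum; sum-replicate-zero)
  open import Algebra.Properties.CommutativeSemigroup *-commutativeSemigroup using (interchange)
  open import Algebra.Definitions.RawSemiring (RawRing.rawSemiring raw) using (_^_)
  open import Relation.Binary.Reasoning.Setoid setoid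

  open IntegerRingSolver R

  linear-coefficient : ∀ s a b x y d → s * ((a * x + b * y) * d) ≈ a * (s * (x * d)) + b * (s * (y * d))
  linear-coefficient = solve 6 (λ s a b x y d →
    s :* ((a :* x :+ b :* y) :* d) := a :* (s :* (x :* d)) :+ b :* (s :* (y :* d))) refl

  linear-cofactor : ∀ s a b x d e → s * (x * (a * d + b * e)) ≈ a * (s * (x * d)) + b * (s * (x * e))
  linear-cofactor = solve 6 (λ s a b x d e →
    s :* (x :* (a :* d :+ b :* e)) := a :* (s :* (x :* d)) :+ b :* (s :* (x :* e))) refl

  sum-0 : ∀ {n} {f : Fin n → Carrier} → (∀ i → f i ≈ 0#) → sum f ≈ 0#
  sum-0 {n} f≈0 = trans (sum-cong-≋ f≈0) (sum-replicate-zero n)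

  sum-linear : ∀ {n} a b (f g : Fin n → Carrier) →
    sum (λ i → a * f i + b * g i) ≈ a * sum f + b * sum g
  sum-linear a b f g = trans (∑-distrib-+ (λ i → a * f i) (λ i → b * g i))
    (+-cong (sym (*-distribˡ-sum a f)) (sym (*-distribˡ-sum b g)))

  sum-↑ : ∀ m {n} (f : Fin (m ℕ.+ n) → Carrier) →
    sum f ≈ sum (λ i → f (i ↑ˡ n)) + sum (λ j → f (m ↑ʳ j))
  sum-↑ zero    f = sym (+-identityˡ _)
  sum-↑ (suc m) f = trans (+-congˡ (sum-↑ m (f ∘ suc))) (sym (+-assoc _ _ _))

  -- The pairs (j, k) with j ≠ punchIn j k come in couples exchanging the two columns j and
  -- punchIn j k; the second pair of the couple is (punchIn j k, pinch k j).
  sum-pairs : ∀ {n} (F : Fin (suc n) → Fin n → Carrier) →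
    (∀ j k → F j k + F (punchIn j k) (pinch k j) ≈ 0#) →
    sum (λ j → sum (F j)) ≈ 0#
  sum-pairs {zero}  F anti = +-identityˡ 0#
  sum-pairs {suc n} F anti = begin
    sum (F zero) + sum (λ j → F (suc j) zero + sum (λ k → F (suc j) (suc k)))
      ≈⟨ +-congˡ (∑-distrib-+ (λ j → F (suc j) zero) (λ j → sum (λ k → F (suc j) (suc k)))) ⟩
    sum (F zero) + (sum (λ j → F (suc j) zero) + sum (λ j → sum (λ k → F (suc j) (suc k))))
      ≈⟨ +-assoc _ _ _ ⟨
    sum (F zero) + sum (λ j → F (suc j) zero) + sum (λ j → sum (λ k → F (suc j) (suc k)))
      -- The pairs that involve column 0 are (0 , k) and (k + 1 , 0), which are partners and cancel
      -- term by term. The remaining pairs form the same kind of sum with one column fewer.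
      ≈⟨ +-cong (sym (∑-distrib-+ (F zero) (λ j → F (suc j) zero)))
           (sum-pairs (λ j k → F (suc j) (suc k)) λ j k → anti (suc j) (suc k)) ⟩
    sum (λ k → F zero k + F (suc k) zero) + 0#
      ≈⟨ +-identityʳ _ ⟩
    sum (λ k → F zero k + F (suc k) zero)
      ≈⟨ sum-0 (anti zero) ⟩
    0# ∎

  sgn : ∀ {n} → Fin n → Carrier
  sgn j = (- 1#) ^ toℕ j

  minor : ∀ {n} → Matrix (suc n) (suc n) → Fin (suc n) → Matrix n n
  minor M j i k = M (suc i) (punchIn j k)

  laplace : ∀ {n} → Matrix (suc n) (suc n) → Fin (suc n) → Carrier
  laplace M j = sgn j * (M zero j * det (minor M j))

  det-cong : ∀ {n} {M N : Matrix n n} → M ≋ N → det M ≈ det N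
  det-cong {zero}  M≋N = refl
  det-cong {suc n} M≋N = sum-cong-≋ λ j →
    *-congˡ {x = sgn j} (*-cong (M≋N zero j) (det-cong λ i k → M≋N (suc i) (punchIn j k)))

  -- Three matrices that agree off row `r` restrict to minors with the same property, which makes
  -- the induction work. If `r` is the first row, the entries combine and the minors agree;
  -- otherwise the entries agree and the minors combine.
  det-linear : ∀ {n} (r : Fin n) a b (L M N : Matrix n n) →
    (∀ i → i ≢ r → ∀ j → L i j ≈ M i j) → (∀ i → i ≢ r → ∀ j → L i j ≈ N i j) →
    (∀ j → L r j ≈ a * M r j + b * N r j) →
    det L ≈ a * det M + b * det N
  det-linear zero a b L M N L≈M L≈N Lr = begin
    det L
      ≈⟨ sum-cong-≋ (λ j → trans
           (*-congˡ {x = sgn j} (*-congʳ (Lr j)))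
           (trans (linear-coefficient (sgn j) a b (M zero j) (N zero j) _) (+-cong
             (*-congˡ {x = a} (*-congˡ {x = sgn j} (*-congˡ (det-cong λ i k → L≈M (suc i) (λ ()) (punchIn j k)))))
             (*-congˡ {x = b} (*-congˡ {x = sgn j} (*-congˡ (det-cong λ i k → L≈N (suc i) (λ ()) (punchIn j k)))))))) ⟩
    sum (λ j → a * laplace M j + b * laplace N j)
      ≈⟨ sum-linear a b (laplace M) (laplace N) ⟩
    a * det M + b * det N ∎
  det-linear {suc n} (suc r) a b L M N L≈M L≈N Lr = begin
    det L
      ≈⟨ sum-cong-≋ (λ j → trans
           (*-congˡ {x = sgn j} (*-congˡ {x = L zero j} (det-linear r a b (minor L j) (minor M j) (minor N j)
             (λ i i≢r k → L≈M (suc i) (i≢r ∘ Fin.suc-injective) (punchIn j k))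
             (λ i i≢r k → L≈N (suc i) (i≢r ∘ Fin.suc-injective) (punchIn j k))
             (λ k → Lr (punchIn j k)))))
           (trans (linear-cofactor (sgn j) a b (L zero j) _ _) (+-cong
             (*-congˡ {x = a} (*-congˡ {x = sgn j} (*-congʳ (L≈M zero (λ ()) j))))
             (*-congˡ {x = b} (*-congˡ {x = sgn j} (*-congʳ (L≈N zero (λ ()) j))))))) ⟩
    sum (λ j → a * laplace M j + b * laplace N j)
      ≈⟨ sum-linear a b (laplace M) (laplace N) ⟩
    a * det M + b * det N ∎

  -- Passing to the partner pair changes the sum of the two positions by exactly one: up if `k` is
  -- at or beyond `j`, down if it is before.
  sgn-swap : ∀ {n} (j : Fin (suc n)) (k : Fin n) →
    sgn (punchIn j k) * sgn (pinch k j) ≈ - (sgn j * sgn k)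
  sgn-swap {suc n} zero k = begin
    - 1# * sgn k * 1#   ≈⟨ *-identityʳ _ ⟩
    - 1# * sgn k        ≈⟨ -‿distribˡ-* 1# (sgn k) ⟨
    - (1# * sgn k)      ∎
  sgn-swap (suc j) zero = begin
    1# * sgn j              ≈⟨ *-identityˡ _ ⟩
    sgn j                   ≈⟨ -‿involutive _ ⟨
    - - sgn j               ≈⟨ -‿cong (-1*x≈-x _) ⟨
    - (- 1# * sgn j)        ≈⟨ -‿cong (*-identityʳ _) ⟨
    - (- 1# * sgn j * 1#)   ∎
  sgn-swap (suc j) (suc k) = begin
    - 1# * sgn (punchIn j k) * (- 1# * sgn (pinch k j))     ≈⟨ interchange (- 1#) _ (- 1#) _ ⟩
    - 1# * - 1# * (sgn (punchIn j k) * sgn (pinch k j))     ≈⟨ *-congˡ (sgn-swap j k) ⟩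
    - 1# * - 1# * - (sgn j * sgn k)
      ≈⟨ solve 3 (λ u s t → u :* u :* :- (s :* t) := :- (u :* s :* (u :* t))) refl (- 1#) _ _ ⟩
    - (- 1# * sgn j * (- 1# * sgn k))                       ∎

  minor₂ : ∀ {n} → Matrix (suc (suc n)) (suc (suc n)) → Fin (suc (suc n)) → Fin (suc n) → Matrix n n
  minor₂ M j = minor (minor M j)

  det-minor₂-swap : ∀ {n} (M : Matrix (suc (suc n)) (suc (suc n))) j k →
    det (minor₂ M j k) ≈ det (minor₂ M (punchIn j k) (pinch k j))
  det-minor₂-swap M j k = det-cong λ i l → reflexive (≡.cong (M (suc (suc i))) (punchIn-comm j k l))

  -- Isolates the first two rows: `minor₂` depends on the other rows only, so facts about rows 0 and
  -- 1 become cancellations in a sum over ordered pairs of columns.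
  det-expand₂ : ∀ {n} (M : Matrix (suc (suc n)) (suc (suc n))) →
    det M ≈ sum (λ j → sum λ k →
      sgn j * sgn k * (M zero j * M (suc zero) (punchIn j k)) * det (minor₂ M j k))
  det-expand₂ M = sum-cong-≋ λ j → begin
    sgn j * (M zero j * det (minor M j))
      ≈⟨ *-congˡ (*-distribˡ-sum (M zero j) (laplace (minor M j))) ⟩
    sgn j * sum (λ k → M zero j * laplace (minor M j) k)
      ≈⟨ *-distribˡ-sum (sgn j) (λ k → M zero j * laplace (minor M j) k) ⟩
    sum (λ k → sgn j * (M zero j * laplace (minor M j) k))
      ≈⟨ sum-cong-≋ (λ k → solve 5 (λ s x t y d → s :* (x :* (t :* (y :* d))) := s :* t :* (x :* y) :* d) refl
          (sgn j) (M zero j) (sgn k) (M (suc zero) (punchIn j k)) (det (minor₂ M j k))) ⟩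
    sum (λ k → sgn j * sgn k * (M zero j * M (suc zero) (punchIn j k)) * det (minor₂ M j k)) ∎

  -- The terms of partner pairs have equal products and opposite signs. Antisymmetry under the
  -- exchange of rows would give only 2 det M = 0, which is weaker in a ring where 2 may be a zero
  -- divisor.
  det-row₀≈row₁ : ∀ {n} (M : Matrix (suc (suc n)) (suc (suc n))) →
    (∀ j → M zero j ≈ M (suc zero) j) → det M ≈ 0#
  det-row₀≈row₁ M M₀≈M₁ = trans (det-expand₂ M) (sum-pairs
    (λ j k → sgn j * sgn k * (M zero j * M (suc zero) (punchIn j k)) * det (minor₂ M j k)) λ j k →
    let j′ = punchIn j k ; k′ = pinch k j in begin
    sgn j * sgn k * (M zero j * M (suc zero) j′) * det (minor₂ M j k)
      + sgn j′ * sgn k′ * (M zero j′ * M (suc zero) (punchIn j′ k′)) * det (minor₂ M j′ k′)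
      ≈⟨ +-congˡ (*-cong (*-cong (sgn-swap j k) (trans (*-comm _ _) (*-cong
           (trans (reflexive (≡.cong (M (suc zero)) (punchIn-punchIn-pinch j k))) (sym (M₀≈M₁ j)))
           (M₀≈M₁ j′)))) (sym (det-minor₂-swap M j k))) ⟩
    sgn j * sgn k * (M zero j * M (suc zero) j′) * det (minor₂ M j k)
      + - (sgn j * sgn k) * (M zero j * M (suc zero) j′) * det (minor₂ M j k)
      ≈⟨ +-congˡ (solve 3 (λ s t d → :- s :* t :* d := :- (s :* t :* d)) refl _ _ _) ⟩
    sgn j * sgn k * (M zero j * M (suc zero) j′) * det (minor₂ M j k)
      + - (sgn j * sgn k * (M zero j * M (suc zero) j′) * det (minor₂ M j k))
      ≈⟨ -‿inverseʳ _ ⟩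
    0# ∎)

  -- The term of `M` at a pair cancels against the term of `N` at the partner pair, so the
  -- cancellation is applied to the sum of both expansions.
  det-swap₀₁ : ∀ {n} (M N : Matrix (suc (suc n)) (suc (suc n))) →
    (∀ j → N zero j ≈ M (suc zero) j) → (∀ j → N (suc zero) j ≈ M zero j) →
    (∀ i j → N (suc (suc i)) j ≈ M (suc (suc i)) j) →
    det M + det N ≈ 0#
  det-swap₀₁ M N N₀ N₁ N₂ = trans (+-cong (det-expand₂ M) N-expand) (trans (sym ∑∑-distrib-+) (sum-pairs
    (λ j k → FM j k + FN j k) λ j k →
    let j′ = punchIn j k ; k′ = pinch k j in begin
    (sgn j * sgn k * (M zero j * M (suc zero) j′) * det (minor₂ M j k)
      + sgn j * sgn k * (M (suc zero) j * M zero j′) * det (minor₂ M j k))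
    + (sgn j′ * sgn k′ * (M zero j′ * M (suc zero) (punchIn j′ k′)) * det (minor₂ M j′ k′)
      + sgn j′ * sgn k′ * (M (suc zero) j′ * M zero (punchIn j′ k′)) * det (minor₂ M j′ k′))
      ≈⟨ +-congˡ (+-cong
          (*-cong (*-cong (sgn-swap j k) (*-congˡ (reflexive (≡.cong (M (suc zero)) (punchIn-punchIn-pinch j k)))))
                  (sym (det-minor₂-swap M j k)))
          (*-cong (*-cong (sgn-swap j k) (*-congˡ (reflexive (≡.cong (M zero) (punchIn-punchIn-pinch j k)))))
                  (sym (det-minor₂-swap M j k)))) ⟩
    (sgn j * sgn k * (M zero j * M (suc zero) j′) * det (minor₂ M j k)
      + sgn j * sgn k * (M (suc zero) j * M zero j′) * det (minor₂ M j k))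
    + (- (sgn j * sgn k) * (M zero j′ * M (suc zero) j) * det (minor₂ M j k)
      + - (sgn j * sgn k) * (M (suc zero) j′ * M zero j) * det (minor₂ M j k))
      ≈⟨ +-congˡ (solve 6 (λ s x y z w d →
           :- s :* (w :* z) :* d :+ :- s :* (y :* x) :* d := :- (s :* (x :* y) :* d :+ s :* (z :* w) :* d))
           refl (sgn j * sgn k) (M zero j) (M (suc zero) j′) (M (suc zero) j) (M zero j′) (det (minor₂ M j k))) ⟩
    (sgn j * sgn k * (M zero j * M (suc zero) j′) * det (minor₂ M j k)
      + sgn j * sgn k * (M (suc zero) j * M zero j′) * det (minor₂ M j k))
    + - (sgn j * sgn k * (M zero j * M (suc zero) j′) * det (minor₂ M j k)
      + sgn j * sgn k * (M (suc zero) j * M zero j′) * det (minor₂ M j k))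
      ≈⟨ -‿inverseʳ _ ⟩
    0# ∎))
    where
    FM FN : _ → _ → Carrier
    FM j k = sgn j * sgn k * (M zero j * M (suc zero) (punchIn j k)) * det (minor₂ M j k)
    FN j k = sgn j * sgn k * (M (suc zero) j * M zero (punchIn j k)) * det (minor₂ M j k)

    N-expand : det N ≈ sum (λ j → sum (FN j))
    N-expand = trans (det-expand₂ N) (sum-cong-≋ λ j → sum-cong-≋ λ k →
      *-cong (*-congˡ {x = sgn j * sgn k} (*-cong (N₀ j) (N₁ (punchIn j k))))
        (det-cong λ i l → N₂ i (punchIn j (punchIn k l))))

    ∑∑-distrib-+ : sum (λ j → sum λ k → FM j k + FN j k) ≈ sum (λ j → sum (FM j)) + sum (λ j → sum (FN j))
    ∑∑-distrib-+ = trans (sum-cong-≋ λ j → ∑-distrib-+ (FM j) (FN j))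
      (∑-distrib-+ (λ j → sum (FM j)) (λ j → sum (FN j)))

  private
    cofactors-0 : ∀ {n} (M : Matrix (suc n) (suc n)) → (∀ j → det (minor M j) ≈ 0#) → det M ≈ 0#
    cofactors-0 M minors≈0 = sum-0 λ j →
      trans (*-congˡ {x = sgn j} (trans (*-congˡ {x = M zero j} (minors≈0 j)) (zeroʳ _))) (zeroʳ _)

    x+y≈0∧y≈0⇒x≈0 : ∀ {x y} → x + y ≈ 0# → y ≈ 0# → x ≈ 0#
    x+y≈0∧y≈0⇒x≈0 x+y≈0 y≈0 = trans (sym (+-identityʳ _)) (trans (+-congˡ (sym y≈0)) x+y≈0)

    swapRows₀₁ : ∀ {m n} → Matrix (suc (suc m)) n → Matrix (suc (suc m)) n
    swapRows₀₁ M zero          = M (suc zero)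
    swapRows₀₁ M (suc zero)    = M zero
    swapRows₀₁ M (suc (suc i)) = M (suc (suc i))

  det-alternating : ∀ {n} (M : Matrix n n) i k → i ≢ k → (∀ j → M i j ≈ M k j) → det M ≈ 0#
  det-alternating M zero zero i≢k _ = contradiction ≡.refl i≢k
  det-alternating M (suc i) (suc k) i≢k Mi≈Mk =
    cofactors-0 M λ j → det-alternating (minor M j) i k (i≢k ∘ ≡.cong suc) λ l → Mi≈Mk (punchIn j l)
  det-alternating M zero (suc zero) _ M₀≈M₁ = det-row₀≈row₁ M M₀≈M₁
  det-alternating M (suc zero) zero _ M₁≈M₀ = det-row₀≈row₁ M (sym ∘ M₁≈M₀)
  -- Exchanging rows 0 and 1 costs a sign and moves both equal rows below row 0, where the induction
  -- applies to every minor.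
  det-alternating M zero (suc (suc k)) _ M₀≈Mk = x+y≈0∧y≈0⇒x≈0
    (det-swap₀₁ M (swapRows₀₁ M) (λ _ → refl) (λ _ → refl) (λ _ _ → refl))
    (cofactors-0 (swapRows₀₁ M) λ j →
      det-alternating (minor (swapRows₀₁ M) j) zero (suc k) (λ ()) λ l → M₀≈Mk (punchIn j l))
  det-alternating M (suc (suc k)) zero _ Mk≈M₀ = x+y≈0∧y≈0⇒x≈0
    (det-swap₀₁ M (swapRows₀₁ M) (λ _ → refl) (λ _ → refl) (λ _ _ → refl))
    (cofactors-0 (swapRows₀₁ M) λ j →
      det-alternating (minor (swapRows₀₁ M) j) (suc k) zero (λ ()) λ l → Mk≈M₀ (punchIn j l))

-- Matrix products, transposes, and inverses of symmetric and diagonal matrices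

module MatrixAlgebra {c ℓ} (R : CommutativeRing c ℓ) where

  open CommutativeRing R hiding (zero) renaming (rawRing to raw)
  open Matrices raw
  open import Algebra.Properties.Semiring.Sum semiring
    using (sum; sum-cong-≋; ∑-comm; *-distribˡ-sum; *-distribʳ-sum)
  open import Relation.Binary.Reasoning.Setoid setoid
  open Determinants R using (sum-0; sgn; minor)

  diag-≡ : ∀ {n} (d : Fin n → Carrier) i → diag d i i ≡ d i
  diag-≡ d zero    = ≡.refl
  diag-≡ d (suc i) = diag-≡ (d ∘ suc) i

  diag-≢ : ∀ {n} (d : Fin n → Carrier) {i j} → i ≢ j → diag d i j ≡ 0#
  diag-≢ d {zero}  {zero}  i≢j = contradiction ≡.refl i≢j
  diag-≢ d {zero}  {suc j} i≢j = ≡.refl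
  diag-≢ d {suc i} {zero}  i≢j = ≡.refl
  diag-≢ d {suc i} {suc j} i≢j = diag-≢ (d ∘ suc) (i≢j ∘ ≡.cong suc)

  diag-sym : ∀ {n} (d : Fin n → Carrier) i j → diag d i j ≡ diag d j i
  diag-sym d zero    zero    = ≡.refl
  diag-sym d zero    (suc j) = ≡.refl
  diag-sym d (suc i) zero    = ≡.refl
  diag-sym d (suc i) (suc j) = diag-sym (d ∘ suc) i j

  I-reindex : ∀ {m n} (f : Fin m → Fin n) → (∀ {i j} → f i ≡ f j → i ≡ j) → ∀ i j → I (f i) (f j) ≡ I i j
  I-reindex f f-injective i j with i Fin.≟ j
  ... | yes ≡.refl = diag-≡ (λ _ → 1#) (f i)
  ... | no i≢j     = diag-≢ (λ _ → 1#) (i≢j ∘ f-injective)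

  sum-*-diag : ∀ {n} (a d : Fin n → Carrier) j → sum (λ i → a i * diag d i j) ≈ a j * d j
  sum-*-diag a d zero    = trans (+-congˡ (sum-0 λ i → zeroʳ (a (suc i)))) (+-identityʳ _)
  sum-*-diag a d (suc j) = begin
    a zero * 0# + sum (λ i → a (suc i) * diag (d ∘ suc) i j)
      ≈⟨ +-cong (zeroʳ (a zero)) (sum-*-diag (a ∘ suc) (d ∘ suc) j) ⟩
    0# + a (suc j) * d (suc j)  ≈⟨ +-identityˡ _ ⟩
    a (suc j) * d (suc j)       ∎

  ⊗-cong : ∀ {m n p} {A A′ : Matrix m n} {B B′ : Matrix n p} → A ≋ A′ → B ≋ B′ → A ⊗ B ≋ A′ ⊗ B′
  ⊗-cong A≋A′ B≋B′ i k = sum-cong-≋ λ j → *-cong (A≋A′ i j) (B≋B′ j k)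

  ⊗-diag : ∀ {m n} (A : Matrix m n) (d : Fin n → Carrier) i j → (A ⊗ diag d) i j ≈ A i j * d j
  ⊗-diag A d i j = sum-*-diag (A i) d j

  diag-⊗ : ∀ {m n} (d : Fin m → Carrier) (A : Matrix m n) i j → (diag d ⊗ A) i j ≈ d i * A i j
  diag-⊗ d A i j = begin
    sum (λ k → diag d i k * A k j)  ≈⟨ sum-cong-≋ (λ k → trans (*-comm _ _) (*-congˡ (reflexive (diag-sym d i k)))) ⟩
    sum (λ k → A k j * diag d k i)  ≈⟨ sum-*-diag (λ k → A k j) d i ⟩
    A i j * d i                     ≈⟨ *-comm _ _ ⟩
    d i * A i j                     ∎

  ⊗-identityʳ : ∀ {m n} (A : Matrix m n) → A ⊗ I ≋ A
  ⊗-identityʳ A i j = trans (⊗-diag A (λ _ → 1#) i j) (*-identityʳ _)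

  ⊗-identityˡ : ∀ {m n} (A : Matrix m n) → I ⊗ A ≋ A
  ⊗-identityˡ A i j = trans (diag-⊗ (λ _ → 1#) A i j) (*-identityˡ _)

  ⊗-assoc : ∀ {m n p q} (A : Matrix m n) (B : Matrix n p) (C : Matrix p q) → A ⊗ B ⊗ C ≋ A ⊗ (B ⊗ C)
  ⊗-assoc A B C i l = begin
    sum (λ k → sum (λ j → A i j * B j k) * C k l)
      ≈⟨ sum-cong-≋ (λ k → *-distribʳ-sum (C k l) (λ j → A i j * B j k)) ⟩
    sum (λ k → sum λ j → A i j * B j k * C k l)
      ≈⟨ ∑-comm (λ k j → A i j * B j k * C k l) ⟩
    sum (λ j → sum λ k → A i j * B j k * C k l)
      ≈⟨ sum-cong-≋ (λ j → sum-cong-≋ λ k → *-assoc (A i j) (B j k) (C k l)) ⟩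
    sum (λ j → sum λ k → A i j * (B j k * C k l))
      ≈⟨ sum-cong-≋ (λ j → *-distribˡ-sum (A i j) (λ k → B j k * C k l)) ⟨
    sum (λ j → A i j * sum (λ k → B j k * C k l)) ∎

  ⊗-ᵀ : ∀ {m n p} (A : Matrix m n) (B : Matrix n p) → (A ⊗ B) ᵀ ≋ B ᵀ ⊗ A ᵀ
  ⊗-ᵀ A B i k = sum-cong-≋ λ j → *-comm (A k j) (B j i)

  Symmetricᴹ : ∀ {n} → Matrix n n → Set ℓ
  Symmetricᴹ M = ∀ i j → M i j ≈ M j i

  ⊗⊗-symmetric : ∀ {n} {A B : Matrix n n} → Symmetricᴹ A → Symmetricᴹ B → Symmetricᴹ (A ⊗ B ⊗ A)
  ⊗⊗-symmetric {A = A} {B} A-sym B-sym i j = begin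
    (A ⊗ B ⊗ A) i j          ≈⟨ ⊗-assoc A B A i j ⟩
    (A ⊗ (B ⊗ A)) i j        ≈⟨ ⊗-cong A-sym (⊗-cong B-sym A-sym) i j ⟩
    (A ᵀ ⊗ (B ᵀ ⊗ A ᵀ)) i j  ≈⟨ ⊗-cong {A = A ᵀ} (λ _ _ → refl) (⊗-ᵀ A B) i j ⟨
    (A ᵀ ⊗ (A ⊗ B) ᵀ) i j    ≈⟨ ⊗-ᵀ (A ⊗ B) A i j ⟨
    (A ⊗ B ⊗ A) j i          ∎

  -- Transposing `M ⊗ N ≋ I` gives the left inverse `N ᵀ`; bracketing `N ᵀ ⊗ M ⊗ N` in both ways
  -- identifies it with `N`.
  symmetric⇒invertible : ∀ {n} {M N : Matrix n n} → Symmetricᴹ M → M ⊗ N ≋ I → Invertible M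
  symmetric⇒invertible {M = M} {N} M-sym MN≋I = record
    { _⁻¹ = N
    ; inverseˡ = λ i j → trans (⊗-cong {B = M} N≋Nᵀ (λ _ _ → refl) i j) (NᵀM≋I i j)
    ; inverseʳ = MN≋I
    }
    where
    NᵀM≋I : N ᵀ ⊗ M ≋ I
    NᵀM≋I i j = begin
      (N ᵀ ⊗ M) i j    ≈⟨ ⊗-cong {A = N ᵀ} (λ _ _ → refl) M-sym i j ⟩
      (N ᵀ ⊗ M ᵀ) i j  ≈⟨ ⊗-ᵀ M N i j ⟨
      (M ⊗ N) j i      ≈⟨ MN≋I j i ⟩
      I j i            ≡⟨ diag-sym (λ _ → 1#) j i ⟩
      I i j            ∎

    N≋Nᵀ : N ≋ N ᵀ
    N≋Nᵀ i j = begin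
      N i j                ≈⟨ ⊗-identityˡ N i j ⟨
      (I ⊗ N) i j          ≈⟨ ⊗-cong {B = N} NᵀM≋I (λ _ _ → refl) i j ⟨
      (N ᵀ ⊗ M ⊗ N) i j    ≈⟨ ⊗-assoc (N ᵀ) M N i j ⟩
      (N ᵀ ⊗ (M ⊗ N)) i j  ≈⟨ ⊗-cong {A = N ᵀ} (λ _ _ → refl) MN≋I i j ⟩
      (N ᵀ ⊗ I) i j        ≈⟨ ⊗-identityʳ (N ᵀ) i j ⟩
      N j i                ∎

  -- The inverse is the visible matrix `diag d`, so that the size of its entries can be read off
  -- later.
  diagonal-invertible : ∀ {n} (M : Matrix n n) (d : Fin n → Carrier) →
    (∀ i → M i i * d i ≈ 1#) → (∀ {i j} → i ≢ j → M i j ≈ 0#) → Invertible M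
  diagonal-invertible M d inverse off-diagonal = record
    { _⁻¹      = diag d
    ; inverseˡ = λ i j → trans (diag-⊗ d M i j) (trans (*-comm (d i) (M i j)) (left i j))
    ; inverseʳ = λ i j → trans (⊗-diag M d i j) (right i j)
    }
    where
    left : ∀ i j → M i j * d i ≈ I i j
    left i j with i Fin.≟ j
    ... | yes ≡.refl = inverse i
    ... | no i≢j     = trans (*-congʳ (off-diagonal i≢j)) (zeroˡ (d i))

    right : ∀ i j → M i j * d j ≈ I i j
    right i j with i Fin.≟ j
    ... | yes ≡.refl = inverse i
    ... | no i≢j     = trans (*-congʳ (off-diagonal i≢j)) (zeroˡ (d j))

  det-I : ∀ n → det (I {n}) ≈ 1#
  det-I zero    = refl
  det-I (suc n) = begin
    det (I {suc n})
      ≈⟨ +-cong (trans (*-identityˡ _) (*-identityˡ _)) (sum-0 {n} λ j →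
           trans (*-congˡ {x = sgn (suc j)} (zeroˡ (det (minor I (suc j))))) (zeroʳ (sgn (suc j)))) ⟩
    det (I {n}) + 0#   ≈⟨ +-identityʳ _ ⟩
    det (I {n})        ≈⟨ det-I n ⟩
    1#                 ∎

-- Row replacement, row operations and the adjugate

module RowOperations {c ℓ} (R : CommutativeRing c ℓ) where

  open CommutativeRing R hiding (zero) renaming (rawRing to raw)
  open Matrices raw
  open import Algebra.Properties.Semiring.Sum semiring
    using (sum; sum-cong-≋; *-distribˡ-sum)
  open import Algebra.Properties.CommutativeSemigroup *-commutativeSemigroup using (x∙yz≈y∙xz)
  open import Relation.Binary.Reasoning.Setoid setoid
  open Determinants R
  open MatrixAlgebra R

  _[_≔_] : ∀ {m n} → Matrix m n → Fin m → (Fin n → Carrier) → Matrix m n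
  M [ r ≔ v ] = updateAt M r (const v)

  ≔-updated : ∀ {m n} (M : Matrix m n) r v j → (M [ r ≔ v ]) r j ≡ v j
  ≔-updated M r v j = ≡.cong-app (updateAt-updates r M) j

  ≔-minimal : ∀ {m n} (M : Matrix m n) {i} r v j → i ≢ r → (M [ r ≔ v ]) i j ≡ M i j
  ≔-minimal M {i} r v j i≢r = ≡.cong-app (updateAt-minimal i r M i≢r) j

  ≔-≋ : ∀ {m n} {M N : Matrix m n} r {v} →
    (∀ i → i ≢ r → ∀ j → M i j ≈ N i j) → (∀ j → v j ≈ N r j) → M [ r ≔ v ] ≋ N
  ≔-≋ {M = M} r {v} M≈N v≈Nr i j with i Fin.≟ r
  ... | yes ≡.refl = trans (reflexive (≔-updated M r v j)) (v≈Nr j)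
  ... | no i≢r     = trans (reflexive (≔-minimal M r v j i≢r)) (M≈N i i≢r j)

  ≔-cong : ∀ {m n} (M : Matrix m n) r {v w} → (∀ j → v j ≈ w j) → M [ r ≔ v ] ≋ M [ r ≔ w ]
  ≔-cong M r {w = w} v≈w = ≔-≋ r
    (λ i i≢r j → reflexive (≡.sym (≔-minimal M r w j i≢r)))
    (λ j → trans (v≈w j) (reflexive (≡.sym (≔-updated M r w j))))

  det-≔-linear : ∀ {n} (M : Matrix n n) r a b u v →
    det (M [ r ≔ (λ j → a * u j + b * v j) ]) ≈ a * det (M [ r ≔ u ]) + b * det (M [ r ≔ v ])
  det-≔-linear M r a b u v = det-linear r a b _ _ _
    (λ i i≢r j → reflexive (≡.trans (≔-minimal M r _ j i≢r) (≡.sym (≔-minimal M r _ j i≢r))))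
    (λ i i≢r j → reflexive (≡.trans (≔-minimal M r _ j i≢r) (≡.sym (≔-minimal M r _ j i≢r))))
    (λ j → trans (reflexive (≔-updated M r _ j)) (+-cong
      (*-congˡ (reflexive (≡.sym (≔-updated M r u j)))) (*-congˡ (reflexive (≡.sym (≔-updated M r v j))))))

  det-≔-0 : ∀ {n} (M : Matrix n n) r {v} → (∀ j → v j ≈ 0#) → det (M [ r ≔ v ]) ≈ 0#
  det-≔-0 M r {v} v≈0 = begin
    det (M [ r ≔ v ])
      ≈⟨ det-cong (≔-cong M r λ j → trans (v≈0 j) (sym (0*+0* (v j) (v j)))) ⟩
    det (M [ r ≔ (λ j → 0# * v j + 0# * v j) ])
      ≈⟨ det-≔-linear M r 0# 0# v v ⟩
    0# * det (M [ r ≔ v ]) + 0# * det (M [ r ≔ v ])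
      ≈⟨ 0*+0* _ _ ⟩
    0# ∎
    where
    0*+0* : ∀ x y → 0# * x + 0# * y ≈ 0#
    0*+0* x y = trans (+-cong (zeroˡ x) (zeroˡ y)) (+-identityʳ 0#)

  det-≔-sum : ∀ {n p} (M : Matrix n n) r (c : Fin p → Carrier) (V : Matrix p n) →
    det (M [ r ≔ (λ j → sum λ k → c k * V k j) ]) ≈ sum (λ k → c k * det (M [ r ≔ V k ]))
  det-≔-sum {p = zero}  M r c V = det-≔-0 M r λ _ → refl
  det-≔-sum {p = suc p} M r c V = begin
    det (M [ r ≔ (λ j → c zero * V zero j + tail j) ])
      ≈⟨ det-cong (≔-cong M r λ j → +-congˡ (sym (*-identityˡ (tail j)))) ⟩
    det (M [ r ≔ (λ j → c zero * V zero j + 1# * tail j) ])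
      ≈⟨ det-≔-linear M r (c zero) 1# (V zero) tail ⟩
    c zero * det (M [ r ≔ V zero ]) + 1# * det (M [ r ≔ tail ])
      ≈⟨ +-congˡ (trans (*-identityˡ _) (det-≔-sum M r (c ∘ suc) (V ∘ suc))) ⟩
    c zero * det (M [ r ≔ V zero ]) + sum (λ k → c (suc k) * det (M [ r ≔ V (suc k) ])) ∎
    where
    tail : Fin _ → Carrier
    tail j = sum λ k → c (suc k) * V (suc k) j

  det-≔-repeated : ∀ {n} (M : Matrix n n) {r i} → i ≢ r → ∀ {v} → (∀ j → M i j ≈ v j) → det (M [ r ≔ v ]) ≈ 0#
  det-≔-repeated M {r} {i} i≢r {v} Mi≈v = det-alternating (M [ r ≔ v ]) i r i≢r λ j →
    trans (reflexive (≔-minimal M r v j i≢r)) (trans (Mi≈v j) (reflexive (≡.sym (≔-updated M r v j))))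

  -- By linearity in row `r`, each added multiple contributes a determinant in which the row `row k`
  -- occurs twice.
  det-addMultiples : ∀ {n p} (M : Matrix n n) r {v} (c : Fin p → Carrier) (row : Fin p → Fin n) →
    (∀ k → row k ≢ r) → (∀ j → v j ≈ M r j + sum (λ k → c k * M (row k) j)) →
    det (M [ r ≔ v ]) ≈ det M
  det-addMultiples M r {v} c row row≢r v≈ = begin
    det (M [ r ≔ v ])
      ≈⟨ det-cong (≔-cong M r λ j → trans (v≈ j) (sym (+-cong (*-identityˡ _) (*-identityˡ _)))) ⟩
    det (M [ r ≔ (λ j → 1# * M r j + 1# * sum (λ k → c k * M (row k) j)) ])
      ≈⟨ det-≔-linear M r 1# 1# (M r) (λ j → sum (λ k → c k * M (row k) j)) ⟩
    1# * det (M [ r ≔ M r ]) + 1# * det (M [ r ≔ (λ j → sum (λ k → c k * M (row k) j)) ])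
      ≈⟨ +-cong (*-identityˡ _) (*-identityˡ _) ⟩
    det (M [ r ≔ M r ]) + det (M [ r ≔ (λ j → sum (λ k → c k * M (row k) j)) ])
      ≈⟨ +-cong (det-cong (≔-≋ r (λ _ _ _ → refl) (λ _ → refl))) (det-≔-sum M r c (λ k → M (row k))) ⟩
    det M + sum (λ k → c k * det (M [ r ≔ M (row k) ]))
      ≈⟨ +-congˡ (sum-0 λ k → trans (*-congˡ (det-≔-repeated M (row≢r k) λ _ → refl)) (zeroʳ (c k))) ⟩
    det M + 0#
      ≈⟨ +-identityʳ _ ⟩
    det M ∎

  -- A cofactor is written as the determinant with row `i` replaced by a unit row. This carries its
  -- own sign, and it turns expansion along an arbitrary row into linearity in that row.
  adjugate : ∀ {n} → Matrix n n → Matrix n n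
  adjugate M j i = det (M [ i ≔ I j ])

  -- Linearity assembles the unit rows to row `k` of `M`, placed in row `i`. For k = i this is `M`
  -- again, otherwise a row is repeated.
  ⊗-adjugate : ∀ {n} (M : Matrix n n) → M ⊗ adjugate M ≋ det M • I
  ⊗-adjugate M k i = begin
    sum (λ j → M k j * det (M [ i ≔ I j ]))              ≈⟨ det-≔-sum M i (M k) I ⟨
    det (M [ i ≔ (λ l → sum (λ j → M k j * I j l)) ])    ≈⟨ det-cong (≔-cong M i (⊗-identityʳ M k)) ⟩
    det (M [ i ≔ M k ])                                  ≈⟨ Mk-in-row-i ⟩
    det M * I k i                                        ∎
    where
    Mk-in-row-i : det (M [ i ≔ M k ]) ≈ det M * I k i
    Mk-in-row-i with k Fin.≟ i
    ... | yes ≡.refl = trans (det-cong (≔-≋ i (λ _ _ _ → refl) (λ _ → refl))) (sym (*-identityʳ _))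
    ... | no k≢i     = trans (det-≔-repeated M k≢i (λ _ → refl)) (sym (zeroʳ _))

  unit-det⇒invertible : ∀ {n} {M : Matrix n n} {u} → Symmetricᴹ M → det M * u ≈ 1# → Invertible M
  unit-det⇒invertible {M = M} {u} M-sym det*u≈1 = symmetric⇒invertible {N = u • adjugate M} M-sym λ k i → begin
    sum (λ j → M k j * (u * adjugate M j i))  ≈⟨ sum-cong-≋ (λ j → x∙yz≈y∙xz (M k j) u (adjugate M j i)) ⟩
    sum (λ j → u * (M k j * adjugate M j i))  ≈⟨ *-distribˡ-sum u (λ j → M k j * adjugate M j i) ⟨
    u * (M ⊗ adjugate M) k i                  ≈⟨ *-congˡ (⊗-adjugate M k i) ⟩
    u * (det M * I k i)                       ≈⟨ *-assoc u (det M) (I k i) ⟨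
    u * det M * I k i                         ≈⟨ *-congʳ (trans (*-comm u (det M)) det*u≈1) ⟩
    1# * I k i                                ≈⟨ *-identityˡ _ ⟩
    I k i                                     ∎

-- Block determinants: Schur complements and the matrix determinant lemma

↑ˡ≢↑ʳ : ∀ {m n} {i : Fin m} {j : Fin n} → i ↑ˡ n ≢ m ↑ʳ j
↑ˡ≢↑ʳ {i = suc i} eq = ↑ˡ≢↑ʳ (Fin.suc-injective eq)

module BlockMatrices {c ℓ} (R : CommutativeRing c ℓ) where

  open CommutativeRing R hiding (zero) renaming (rawRing to raw)
  open Matrices raw
  open import Algebra.Properties.Ring ring using (-0#≈0#; -‿distribˡ-*; -1*x≈-x)
  open import Algebra.Properties.Semiring.Sum semiring
    using (sum; sum-cong-≋; *-distribˡ-sum; *-distribʳ-sum)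
  open import Algebra.Definitions.RawSemiring (RawRing.rawSemiring raw) using (_^_)
  open import Relation.Binary.Reasoning.Setoid setoid
  open Determinants R
  open MatrixAlgebra R
  open RowOperations R
  open IntegerRingSolver R

  -‿sum : ∀ {n} {f g : Fin n → Carrier} → (∀ i → f i ≈ - g i) → sum f ≈ - sum g
  -‿sum {f = f} {g} f≈-g = begin
    sum f                     ≈⟨ sum-cong-≋ (λ i → trans (f≈-g i) (sym (-1*x≈-x (g i)))) ⟩
    sum (λ i → - 1# * g i)    ≈⟨ *-distribˡ-sum (- 1#) g ⟨
    - 1# * sum g              ≈⟨ -1*x≈-x (sum g) ⟩
    - sum g                   ∎

  M₁₁ : ∀ m {n} → Matrix (m ℕ.+ n) (m ℕ.+ n) → Matrix m m
  M₁₁ m {n} M i j = M (i ↑ˡ n) (j ↑ˡ n)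

  M₁₂ : ∀ m {n} → Matrix (m ℕ.+ n) (m ℕ.+ n) → Matrix m n
  M₁₂ m {n} M i j = M (i ↑ˡ n) (m ↑ʳ j)

  M₂₁ : ∀ m {n} → Matrix (m ℕ.+ n) (m ℕ.+ n) → Matrix n m
  M₂₁ m {n} M i j = M (m ↑ʳ i) (j ↑ˡ n)

  M₂₂ : ∀ m {n} → Matrix (m ℕ.+ n) (m ℕ.+ n) → Matrix n n
  M₂₂ m {n} M i j = M (m ↑ʳ i) (m ↑ʳ j)

  stack : ∀ {m n p} → Matrix m p → Matrix n p → Matrix (m ℕ.+ n) p
  stack {m} P Q i = [ P , Q ]′ (splitAt m i)

  stack-↑ˡ : ∀ {m n p} (P : Matrix m p) (Q : Matrix n p) i j → stack P Q (i ↑ˡ n) j ≡ P i j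
  stack-↑ˡ {m} {n} P Q i j = ≡.cong (λ s → [ P , Q ]′ s j) (Fin.splitAt-↑ˡ m i n)

  stack-↑ʳ : ∀ {m n p} (P : Matrix m p) (Q : Matrix n p) i j → stack P Q (m ↑ʳ i) j ≡ Q i j
  stack-↑ʳ {m} {n} P Q i j = ≡.cong (λ s → [ P , Q ]′ s j) (Fin.splitAt-↑ʳ m n i)

  -- With a vanishing upper right block, the first row has entries only in the left columns. The
  -- minors there have the same shape and the same lower right block, whose determinant factors out
  -- of the expansion.
  det-lowerTriangular : ∀ m {n} (M : Matrix (m ℕ.+ n) (m ℕ.+ n)) →
    (∀ i j → M₁₂ m M i j ≈ 0#) → det M ≈ det (M₁₁ m M) * det (M₂₂ m M)
  det-lowerTriangular zero        M M₁₂≈0 = sym (*-identityˡ _)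
  det-lowerTriangular (suc m) {n} M M₁₂≈0 = begin
    det M
      ≈⟨ sum-↑ (suc m) (laplace M) ⟩
    sum (λ j → laplace M (j ↑ˡ n)) + sum (λ j → laplace M (suc m ↑ʳ j))
      ≈⟨ +-cong (sum-cong-≋ left) (sum-0 right) ⟩
    sum (λ j → laplace (M₁₁ (suc m) M) j * det (M₂₂ (suc m) M)) + 0#
      ≈⟨ +-identityʳ _ ⟩
    sum (λ j → laplace (M₁₁ (suc m) M) j * det (M₂₂ (suc m) M))
      ≈⟨ *-distribʳ-sum (det (M₂₂ (suc m) M)) (laplace (M₁₁ (suc m) M)) ⟨
    det (M₁₁ (suc m) M) * det (M₂₂ (suc m) M) ∎
    where
    left : ∀ j → laplace M (j ↑ˡ n) ≈ laplace (M₁₁ (suc m) M) j * det (M₂₂ (suc m) M)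
    left j = begin
      sgn (j ↑ˡ n) * (M zero (j ↑ˡ n) * det (minor M (j ↑ˡ n)))
        ≈⟨ *-cong (reflexive (≡.cong ((- 1#) ^_) (Fin.toℕ-↑ˡ j n))) (*-congˡ (begin
          det (minor M (j ↑ˡ n))
            ≈⟨ det-lowerTriangular m (minor M (j ↑ˡ n)) (λ i k →
                 trans (reflexive (≡.cong (M (suc (i ↑ˡ n))) (punchIn-↑ˡ-↑ʳ j k))) (M₁₂≈0 (suc i) k)) ⟩
          det (M₁₁ m (minor M (j ↑ˡ n))) * det (M₂₂ m (minor M (j ↑ˡ n)))
            ≈⟨ *-cong
                (det-cong λ i k → reflexive (≡.cong (M (suc i ↑ˡ n)) (punchIn-↑ˡ-↑ˡ n j k)))
                (det-cong λ i k → reflexive (≡.cong (M (suc m ↑ʳ i)) (punchIn-↑ˡ-↑ʳ j k))) ⟩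
          det (minor (M₁₁ (suc m) M) j) * det (M₂₂ (suc m) M) ∎)) ⟩
      sgn j * (M zero (j ↑ˡ n) * (det (minor (M₁₁ (suc m) M) j) * det (M₂₂ (suc m) M)))
        ≈⟨ solve 4 (λ s x d e → s :* (x :* (d :* e)) := s :* (x :* d) :* e) refl (sgn j) _ _ _ ⟩
      laplace (M₁₁ (suc m) M) j * det (M₂₂ (suc m) M) ∎

    right : ∀ j → laplace M (suc m ↑ʳ j) ≈ 0#
    right j = trans (*-congˡ {x = sgn (suc m ↑ʳ j)} (trans (*-congʳ (M₁₂≈0 zero j)) (zeroˡ _))) (zeroʳ _)

  -- Induction over the upper rows: `det-addMultiples` treats the first one, and the others are
  -- treated inside the minors along it, which still contain all lower rows.
  det-addLowerRows : ∀ m {n} (K : Matrix m n) (M N : Matrix (m ℕ.+ n) (m ℕ.+ n)) →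
    (∀ i j → N (i ↑ˡ n) j ≈ M (i ↑ˡ n) j + sum (λ k → K i k * M (m ↑ʳ k) j)) →
    (∀ i j → N (m ↑ʳ i) j ≈ M (m ↑ʳ i) j) →
    det N ≈ det M
  det-addLowerRows zero    K M N upper lower = det-cong lower
  det-addLowerRows (suc m) K M N upper lower = begin
    det N
      ≈⟨ det-cong (≔-≋ {M = N₀} zero N₀-minimal (λ _ → refl)) ⟨
    det (N₀ [ zero ≔ N zero ])
      ≈⟨ det-addMultiples N₀ zero (K zero) (suc m ↑ʳ_) (λ _ ()) (λ j → trans (upper zero j)
           (+-congˡ (sum-cong-≋ λ k → *-congˡ {x = K zero k} (sym (lower k j))))) ⟩
    det N₀
      ≈⟨ sum-cong-≋ (λ j → *-congˡ {x = sgn j} (*-congˡ {x = M zero j}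
           (det-addLowerRows m (K ∘ suc) (minor M j) (minor N j)
             (λ i k → upper (suc i) (punchIn j k)) (λ i k → lower i (punchIn j k))))) ⟩
    det M ∎
    where
    N₀ = N [ zero ≔ M zero ]
    N₀-minimal : ∀ i → i ≢ zero → ∀ j → N₀ i j ≈ N i j
    N₀-minimal i i≢0 j = reflexive (≔-minimal N zero (M zero) j i≢0)

  -- Adding - M₁₂ F times the lower rows to the upper ones clears the block M₁₂.
  det-schurComplement : ∀ m {n} (M : Matrix (m ℕ.+ n) (m ℕ.+ n)) (F : Matrix n n) → F ⊗ M₂₂ m M ≋ I →
    det M ≈ det (M₁₁ m M ⊟ M₁₂ m M ⊗ F ⊗ M₂₁ m M) * det (M₂₂ m M)
  det-schurComplement m {n} M F FM₂₂≋I = begin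
    det M
      ≈⟨ det-addLowerRows m K M N (λ i j → reflexive (stack-↑ˡ upper lower i j))
           (λ i j → reflexive (stack-↑ʳ upper lower i j)) ⟨
    det N
      ≈⟨ det-lowerTriangular m N (λ i j → trans (reflexive (stack-↑ˡ upper lower i (m ↑ʳ j))) (N₁₂≈0 i j)) ⟩
    det (M₁₁ m N) * det (M₂₂ m N)
      ≈⟨ *-cong
          (det-cong λ i j → trans (reflexive (stack-↑ˡ upper lower i (j ↑ˡ n)))
            (+-congˡ (K-* i (λ k → M₂₁ m M k j))))
          (det-cong λ i j → reflexive (stack-↑ʳ upper lower i (m ↑ʳ j))) ⟩
    det (M₁₁ m M ⊟ M₁₂ m M ⊗ F ⊗ M₂₁ m M) * det (M₂₂ m M) ∎
    where
    K : Matrix m n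
    K i k = - (M₁₂ m M ⊗ F) i k

    upper : Matrix m (m ℕ.+ n)
    upper i j = M (i ↑ˡ n) j + sum (λ k → K i k * M (m ↑ʳ k) j)

    lower : Matrix n (m ℕ.+ n)
    lower i = M (m ↑ʳ i)

    N : Matrix (m ℕ.+ n) (m ℕ.+ n)
    N = stack upper lower

    K-* : ∀ i (v : Fin n → Carrier) → sum (λ k → K i k * v k) ≈ - sum (λ k → (M₁₂ m M ⊗ F) i k * v k)
    K-* i v = -‿sum λ k → sym (-‿distribˡ-* ((M₁₂ m M ⊗ F) i k) (v k))

    N₁₂≈0 : ∀ i j → M₁₂ m M i j + sum (λ k → K i k * M₂₂ m M k j) ≈ 0#
    N₁₂≈0 i j = begin
      M₁₂ m M i j + sum (λ k → K i k * M₂₂ m M k j)     ≈⟨ +-congˡ (K-* i (λ k → M₂₂ m M k j)) ⟩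
      M₁₂ m M i j + - (M₁₂ m M ⊗ F ⊗ M₂₂ m M) i j       ≈⟨ +-congˡ (-‿cong (begin
        (M₁₂ m M ⊗ F ⊗ M₂₂ m M) i j      ≈⟨ ⊗-assoc (M₁₂ m M) F (M₂₂ m M) i j ⟩
        (M₁₂ m M ⊗ (F ⊗ M₂₂ m M)) i j    ≈⟨ ⊗-cong {A = M₁₂ m M} (λ _ _ → refl) FM₂₂≋I i j ⟩
        (M₁₂ m M ⊗ I) i j                ≈⟨ ⊗-identityʳ (M₁₂ m M) i j ⟩
        M₁₂ m M i j                      ∎)) ⟩
      M₁₂ m M i j + - M₁₂ m M i j                       ≈⟨ -‿inverseʳ _ ⟩
      0# ∎

  det-1×1 : (M : Matrix 1 1) → det M ≈ M zero zero
  det-1×1 M = trans (+-identityʳ _) (trans (*-identityˡ _) (*-identityʳ _))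

  -- The opposite triangular shape, for a corner of size one, again by expansion along the first
  -- row: the minor at the last column has a zero row, and the other minors keep the shape and the
  -- corner.
  det-lastRow : ∀ n (M : Matrix (n ℕ.+ 1) (n ℕ.+ 1)) → (∀ i j → M₂₁ n M i j ≈ 0#) →
    det M ≈ det (M₁₁ n M) * M₂₂ n M zero zero
  det-lastRow zero    M M₂₁≈0 = trans (det-1×1 M) (sym (*-identityˡ _))
  det-lastRow (suc n) M M₂₁≈0 = begin
    det M
      ≈⟨ sum-↑ (suc n) (laplace M) ⟩
    sum {suc n} (λ j → laplace M (j ↑ˡ 1)) + (laplace M last + 0#)
      ≈⟨ +-cong (sum-cong-≋ {suc n} left) (trans (+-identityʳ _) right) ⟩
    sum (λ j → laplace (M₁₁ (suc n) M) j * M last last) + 0#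
      ≈⟨ +-identityʳ _ ⟩
    sum (λ j → laplace (M₁₁ (suc n) M) j * M last last)
      ≈⟨ *-distribʳ-sum (M last last) (laplace (M₁₁ (suc n) M)) ⟨
    det (M₁₁ (suc n) M) * M last last ∎
    where
    last : Fin (suc n ℕ.+ 1)
    last = suc n ↑ʳ zero

    M-last≈0 : ∀ j → j ≢ last → M last j ≈ 0#
    M-last≈0 = ↑-elim (suc n) _ (λ j _ → M₂₁≈0 zero j) (λ { zero last≢last → contradiction ≡.refl last≢last })

    left : ∀ j → laplace M (j ↑ˡ 1) ≈ laplace (M₁₁ (suc n) M) j * M last last
    left j = begin
      sgn (j ↑ˡ 1) * (M zero (j ↑ˡ 1) * det (minor M (j ↑ˡ 1)))
        ≈⟨ *-cong (reflexive (≡.cong ((- 1#) ^_) (Fin.toℕ-↑ˡ j 1))) (*-congˡ (begin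
          det (minor M (j ↑ˡ 1))
            ≈⟨ det-lastRow n (minor M (j ↑ˡ 1)) (λ { zero k → M-last≈0 _ λ eq →
                 ↑ˡ≢↑ʳ (≡.trans (≡.sym (punchIn-↑ˡ-↑ˡ 1 j k)) eq) }) ⟩
          det (M₁₁ n (minor M (j ↑ˡ 1))) * M last (punchIn (j ↑ˡ 1) (n ↑ʳ zero))
            ≈⟨ *-cong
                (det-cong λ i k → reflexive (≡.cong (M (suc i ↑ˡ 1)) (punchIn-↑ˡ-↑ˡ 1 j k)))
                (reflexive (≡.cong (M last) (punchIn-↑ˡ-↑ʳ j zero))) ⟩
          det (minor (M₁₁ (suc n) M) j) * M last last ∎)) ⟩
      sgn j * (M zero (j ↑ˡ 1) * (det (minor (M₁₁ (suc n) M) j) * M last last))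
        ≈⟨ solve 4 (λ s x d e → s :* (x :* (d :* e)) := s :* (x :* d) :* e) refl (sgn j) _ _ _ ⟩
      laplace (M₁₁ (suc n) M) j * M last last ∎

    right : laplace M last ≈ 0#
    right = trans (*-congˡ {x = sgn last} (trans (*-congˡ {x = M zero last} (begin
      det (minor M last)
        ≈⟨ det-cong (≔-≋ (n ↑ʳ zero {0}) {v = minor M last (n ↑ʳ zero)} (λ _ _ _ → refl) (λ _ → refl)) ⟨
      det (minor M last [ n ↑ʳ zero ≔ minor M last (n ↑ʳ zero) ])
        ≈⟨ det-≔-0 (minor M last) (n ↑ʳ zero) (λ k → M-last≈0 _ (Fin.punchInᵢ≢i last k)) ⟩
      0# ∎)) (zeroʳ _))) (zeroʳ _)

  -- This is the coronal without the pencil: `Γ M y inv` unfolds to `entrySum (inv ⁻¹)`.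
  entrySum : ∀ {n} → Matrix n n → Carrier
  entrySum W = (𝟏 ᵀ ⊗ W ⊗ 𝟏) zero zero

  -- Both sides are the determinant of Z bordered by the column γ 𝟏, the row 𝟏ᵀ and the corner 1.
  det-matrixDeterminantLemma : ∀ {n} (Z : Matrix n n) (inv : Invertible Z) γ →
    det (λ i j → Z i j + - γ) ≈ det Z * (1# + - (γ * entrySum (inv ⁻¹)))
  det-matrixDeterminantLemma {n} Z inv γ = begin
    det (λ i j → Z i j + - γ)
      ≈⟨ *-identityʳ _ ⟨
    det (λ i j → Z i j + - γ) * 1#
      ≈⟨ *-cong (det-cong complement≋) (trans (det-1×1 (M₂₂ n B)) (reflexive B₂₂)) ⟨
    det (M₁₁ n B ⊟ M₁₂ n B ⊗ I ⊗ M₂₁ n B) * det (M₂₂ n B)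
      ≈⟨ det-schurComplement n B I (λ i j → trans (⊗-identityˡ (M₂₂ n B) i j) (M₂₂≋I i j)) ⟨
    det B
      -- The first evaluation eliminated the corner 1. For the second, the combination of the upper
      -- rows with weights `w` = 𝟏ᵀ Z⁻¹ is subtracted from the last row: this clears 𝟏ᵀ, since 𝟏ᵀ
      -- Z⁻¹ Z = 𝟏ᵀ, and leaves 1 - γ 𝟏ᵀ Z⁻¹ 𝟏 in the corner.
      ≈⟨ det-addMultiples B (n ↑ʳ zero) (λ k → - w k) (_↑ˡ 1) (λ _ → ↑ˡ≢↑ʳ) (λ _ → refl) ⟨
    det (B [ n ↑ʳ zero ≔ v ])
      ≈⟨ det-lastRow n (B [ n ↑ʳ zero ≔ v ]) (λ { zero j →
           trans (reflexive (≔-updated B (n ↑ʳ zero) v (j ↑ˡ 1))) (v-left j) }) ⟩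
    det (M₁₁ n (B [ n ↑ʳ zero ≔ v ])) * (B [ n ↑ʳ zero ≔ v ]) (n ↑ʳ zero) (n ↑ʳ zero)
      ≈⟨ *-cong
          (det-cong λ i j → reflexive (≡.trans (≔-minimal B (n ↑ʳ zero) v (j ↑ˡ 1) ↑ˡ≢↑ʳ) (B₁₁ i j)))
          (trans (reflexive (≔-updated B (n ↑ʳ zero) v (n ↑ʳ zero))) v-right) ⟩
    det Z * (1# + - (γ * entrySum (inv ⁻¹))) ∎
    where
    entry : Fin n ⊎ Fin 1 → Fin n ⊎ Fin 1 → Carrier
    entry (inj₁ i) (inj₁ j) = Z i j
    entry (inj₁ i) (inj₂ _) = γ
    entry (inj₂ _) _        = 1#

    B : Matrix (n ℕ.+ 1) (n ℕ.+ 1)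
    B i j = entry (splitAt n i) (splitAt n j)

    B₁₁ : ∀ i j → B (i ↑ˡ 1) (j ↑ˡ 1) ≡ Z i j
    B₁₁ i j = ≡.cong₂ entry (Fin.splitAt-↑ˡ n i 1) (Fin.splitAt-↑ˡ n j 1)

    B₁₂ : ∀ i → B (i ↑ˡ 1) (n ↑ʳ zero) ≡ γ
    B₁₂ i = ≡.cong₂ entry (Fin.splitAt-↑ˡ n i 1) (Fin.splitAt-↑ʳ n 1 zero)

    B₂₁ : ∀ j → B (n ↑ʳ zero) (j ↑ˡ 1) ≡ 1#
    B₂₁ j = ≡.cong₂ entry (Fin.splitAt-↑ʳ n 1 zero) (Fin.splitAt-↑ˡ n j 1)

    B₂₂ : B (n ↑ʳ zero) (n ↑ʳ zero) ≡ 1#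
    B₂₂ = ≡.cong₂ entry (Fin.splitAt-↑ʳ n 1 zero) (Fin.splitAt-↑ʳ n 1 zero)

    M₂₂≋I : M₂₂ n B ≋ I
    M₂₂≋I zero zero = reflexive B₂₂

    complement≋ : M₁₁ n B ⊟ M₁₂ n B ⊗ I ⊗ M₂₁ n B ≋ λ i j → Z i j + - γ
    complement≋ i j = +-cong (reflexive (B₁₁ i j)) (-‿cong (begin
      (M₁₂ n B ⊗ I ⊗ M₂₁ n B) i j
        ≈⟨ ⊗-cong {B = M₂₁ n B} (⊗-identityʳ (M₁₂ n B)) (λ _ _ → refl) i j ⟩
      B (i ↑ˡ 1) (n ↑ʳ zero) * B (n ↑ʳ zero) (j ↑ˡ 1) + 0#
        ≈⟨ +-identityʳ _ ⟩
      B (i ↑ˡ 1) (n ↑ʳ zero) * B (n ↑ʳ zero) (j ↑ˡ 1)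
        ≈⟨ *-cong (reflexive (B₁₂ i)) (reflexive (B₂₁ j)) ⟩
      γ * 1#
        ≈⟨ *-identityʳ γ ⟩
      γ ∎))

    w : Fin n → Carrier
    w = (𝟏 ᵀ ⊗ inv ⁻¹) zero

    v : Fin (n ℕ.+ 1) → Carrier
    v j = B (n ↑ʳ zero) j + sum (λ k → - w k * B (k ↑ˡ 1) j)

    v-left : ∀ j → v (j ↑ˡ 1) ≈ 0#
    v-left j = begin
      v (j ↑ˡ 1)
        ≈⟨ +-cong (reflexive (B₂₁ j)) (-‿sum λ k →
             trans (*-congˡ {x = - w k} (reflexive (B₁₁ k j))) (sym (-‿distribˡ-* (w k) (Z k j)))) ⟩
      1# + - (𝟏 ᵀ ⊗ inv ⁻¹ ⊗ Z) zero j
        ≈⟨ +-congˡ (-‿cong (begin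
          (𝟏 ᵀ ⊗ inv ⁻¹ ⊗ Z) zero j      ≈⟨ ⊗-assoc (𝟏 ᵀ) (inv ⁻¹) Z zero j ⟩
          (𝟏 ᵀ ⊗ (inv ⁻¹ ⊗ Z)) zero j    ≈⟨ ⊗-cong {A = 𝟏 ᵀ} (λ _ _ → refl) (Invertible.inverseˡ inv) zero j ⟩
          (𝟏 ᵀ ⊗ I) zero j               ≈⟨ ⊗-identityʳ (𝟏 ᵀ) zero j ⟩
          1#                             ∎)) ⟩
      1# + - 1#
        ≈⟨ -‿inverseʳ 1# ⟩
      0# ∎

    v-right : v (n ↑ʳ zero) ≈ 1# + - (γ * entrySum (inv ⁻¹))
    v-right = +-cong (reflexive B₂₂) (begin
      sum (λ k → - w k * B (k ↑ˡ 1) (n ↑ʳ zero))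
        ≈⟨ -‿sum (λ k → trans (*-congˡ {x = - w k} (reflexive (B₁₂ k)))
             (trans
             (solve 2 (λ w g → :- w :* g := :- (g :* w)) refl (w k) γ) (-‿cong (*-congˡ (sym (*-identityʳ (w k))))))) ⟩
      - sum (λ k → γ * (w k * 1#))
        ≈⟨ -‿cong (*-distribˡ-sum γ (λ k → w k * 1#)) ⟨
      - (γ * entrySum (inv ⁻¹)) ∎)

  -- No v is adjacent to any u′, so eliminating u′ alters only the (u , u) block; that block is
  -- therefore prescribed as Z + C X⁻¹ C. Eliminating v then subtracts one and the same number, the
  -- entry sum of Y⁻¹, from every entry of Z.
  det-join : ∀ n₁ n₂ (M : Matrix (n₁ ℕ.+ n₂ ℕ.+ n₁) (n₁ ℕ.+ n₂ ℕ.+ n₁))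
    {X C Z : Matrix n₁ n₁} {Y : Matrix n₂ n₂}
    (X-inv : Invertible X) (Y-inv : Invertible Y) (Z-inv : Invertible Z) →
    M₂₂ (n₁ ℕ.+ n₂) M ≋ X →
    M₂₂ n₁ (M₁₁ (n₁ ℕ.+ n₂) M) ≋ Y →
    (∀ i j → M₁₁ n₁ (M₁₁ (n₁ ℕ.+ n₂) M) i j ≈ Z i j + (C ⊗ X-inv ⁻¹ ⊗ C) i j) →
    (∀ i j → M₁₂ n₁ (M₁₁ (n₁ ℕ.+ n₂) M) i j ≈ - 1#) →
    (∀ i j → M₂₁ n₁ (M₁₁ (n₁ ℕ.+ n₂) M) i j ≈ - 1#) →
    (∀ i j → M₁₂ (n₁ ℕ.+ n₂) M (i ↑ˡ n₂) j ≈ - C i j) →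
    (∀ i j → M₁₂ (n₁ ℕ.+ n₂) M (n₁ ↑ʳ i) j ≈ 0#) →
    (∀ i j → M₂₁ (n₁ ℕ.+ n₂) M i (j ↑ˡ n₂) ≈ - C i j) →
    (∀ i j → M₂₁ (n₁ ℕ.+ n₂) M i (n₁ ↑ʳ j) ≈ 0#) →
    det M ≈ det Y * det X * det Z * (1# + - (entrySum (Y-inv ⁻¹) * entrySum (Z-inv ⁻¹)))
  det-join n₁ n₂ M {X} {C} {Z} {Y} X-inv Y-inv Z-inv M-X M-Y M-Z uv vu uu′ vu′ u′u u′v = begin
    det M
      ≈⟨ det-schurComplement (n₁ ℕ.+ n₂) M F (λ i j →
           trans (⊗-cong {A = F} (λ _ _ → refl) M-X i j) (Invertible.inverseˡ X-inv i j)) ⟩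
    det N * det (M₂₂ (n₁ ℕ.+ n₂) M)
      ≈⟨ *-cong (det-schurComplement n₁ N (Y-inv ⁻¹) (λ i j →
           trans (⊗-cong {A = Y-inv ⁻¹} (λ _ _ → refl) N₂₂ i j) (Invertible.inverseˡ Y-inv i j))) (det-cong M-X) ⟩
    det (M₁₁ n₁ N ⊟ M₁₂ n₁ N ⊗ Y-inv ⁻¹ ⊗ M₂₁ n₁ N) * det (M₂₂ n₁ N) * det X
      ≈⟨ *-congʳ (*-cong (det-cong complement≋) (det-cong N₂₂)) ⟩
    det (λ i j → Z i j + - entrySum (Y-inv ⁻¹)) * det Y * det X
      ≈⟨ *-congʳ (*-congʳ (det-matrixDeterminantLemma Z Z-inv (entrySum (Y-inv ⁻¹)))) ⟩
    det Z * (1# + - (entrySum (Y-inv ⁻¹) * entrySum (Z-inv ⁻¹))) * det Y * det X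
      ≈⟨ solve 4 (λ z g y x → z :* g :* y :* x := y :* x :* z :* g) refl _ _ _ _ ⟩
    det Y * det X * det Z * (1# + - (entrySum (Y-inv ⁻¹) * entrySum (Z-inv ⁻¹))) ∎
    where
    F : Matrix n₁ n₁
    F = X-inv ⁻¹

    T : Matrix (n₁ ℕ.+ n₂) n₁
    T = M₁₂ (n₁ ℕ.+ n₂) M

    S : Matrix n₁ (n₁ ℕ.+ n₂)
    S = M₂₁ (n₁ ℕ.+ n₂) M

    N : Matrix (n₁ ℕ.+ n₂) (n₁ ℕ.+ n₂)
    N = M₁₁ (n₁ ℕ.+ n₂) M ⊟ T ⊗ F ⊗ S

    TFS≈0ˡ : ∀ i j → (T ⊗ F ⊗ S) (n₁ ↑ʳ i) j ≈ 0#
    TFS≈0ˡ i j = sum-0 λ k → trans (*-congʳ (sum-0 λ l →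
      trans (*-congʳ (vu′ i l)) (zeroˡ (F l k)))) (zeroˡ (S k j))

    TFS≈0ʳ : ∀ i j → (T ⊗ F ⊗ S) i (n₁ ↑ʳ j) ≈ 0#
    TFS≈0ʳ i j = sum-0 λ k → trans (*-congˡ {x = (T ⊗ F) i k} (u′v k j)) (zeroʳ ((T ⊗ F) i k))

    x-0 : ∀ {x y} → y ≈ 0# → x + - y ≈ x
    x-0 {x} y≈0 = trans (+-congˡ (trans (-‿cong y≈0) -0#≈0#)) (+-identityʳ x)

    N₁₁ : M₁₁ n₁ N ≋ Z
    N₁₁ i j = begin
      M₁₁ n₁ (M₁₁ (n₁ ℕ.+ n₂) M) i j + - (T ⊗ F ⊗ S) (i ↑ˡ n₂) (j ↑ˡ n₂)
        ≈⟨ +-cong (M-Z i j) (-‿cong (sum-cong-≋ λ k → begin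
             sum (λ l → T (i ↑ˡ n₂) l * F l k) * S k (j ↑ˡ n₂)
               ≈⟨ *-cong (-‿sum λ l → trans (*-congʳ (uu′ i l)) (sym (-‿distribˡ-* (C i l) (F l k)))) (u′u k j) ⟩
             - (C ⊗ F) i k * - C k j
               ≈⟨ solve 2 (λ a b → :- a :* :- b := a :* b) refl ((C ⊗ F) i k) (C k j) ⟩
             (C ⊗ F) i k * C k j ∎)) ⟩
      Z i j + (C ⊗ F ⊗ C) i j + - (C ⊗ F ⊗ C) i j
        ≈⟨ solve 2 (λ z g → z :+ g :- g := z) refl (Z i j) ((C ⊗ F ⊗ C) i j) ⟩
      Z i j ∎

    N₁₂ : ∀ i j → M₁₂ n₁ N i j ≈ - 1#
    N₁₂ i j = trans (x-0 (TFS≈0ʳ (i ↑ˡ n₂) j)) (uv i j)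

    N₂₁ : ∀ i j → M₂₁ n₁ N i j ≈ - 1#
    N₂₁ i j = trans (x-0 (TFS≈0ˡ i (j ↑ˡ n₂))) (vu i j)

    N₂₂ : M₂₂ n₁ N ≋ Y
    N₂₂ i j = trans (x-0 (TFS≈0ʳ (n₁ ↑ʳ i) j)) (M-Y i j)

    complement≋ : M₁₁ n₁ N ⊟ M₁₂ n₁ N ⊗ Y-inv ⁻¹ ⊗ M₂₁ n₁ N ≋ λ i j → Z i j + - entrySum (Y-inv ⁻¹)
    complement≋ i j = +-cong (N₁₁ i j) (-‿cong (sum-cong-≋ λ k → begin
      sum (λ l → M₁₂ n₁ N i l * (Y-inv ⁻¹) l k) * M₂₁ n₁ N k j
        ≈⟨ *-cong (-‿sum λ l → trans (*-congʳ (N₁₂ i l)) (sym (-‿distribˡ-* 1# ((Y-inv ⁻¹) l k)))) (N₂₁ k j) ⟩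
      - (𝟏 ᵀ ⊗ Y-inv ⁻¹) zero k * - 1#
        ≈⟨ solve 2 (λ a b → :- a :* :- b := a :* b) refl ((𝟏 ᵀ ⊗ Y-inv ⁻¹) zero k) 1# ⟩
      (𝟏 ᵀ ⊗ Y-inv ⁻¹) zero k * 1# ∎))

-- Signless Laplacians of splitting joins

open Graph

uᵢ : ∀ {n₁} n₂ → Fin n₁ → Fin (n₁ ℕ.+ n₂ ℕ.+ n₁)
uᵢ {n₁} n₂ i = i ↑ˡ n₂ ↑ˡ n₁

vᵢ : ∀ n₁ {n₂} → Fin n₂ → Fin (n₁ ℕ.+ n₂ ℕ.+ n₁)
vᵢ n₁ i = (n₁ ↑ʳ i) ↑ˡ n₁

u′ᵢ : ∀ {n₁} n₂ → Fin n₁ → Fin (n₁ ℕ.+ n₂ ℕ.+ n₁)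
u′ᵢ {n₁} n₂ i = (n₁ ℕ.+ n₂) ↑ʳ i

vertex-u : ∀ n₁ n₂ i → vertex n₁ n₂ (uᵢ n₂ i) ≡ inj₁ (inj₁ i)
vertex-u n₁ n₂ i = ≡.trans (≡.cong (map₁ (splitAt n₁)) (Fin.splitAt-↑ˡ (n₁ ℕ.+ n₂) (i ↑ˡ n₂) n₁))
  (≡.cong inj₁ (Fin.splitAt-↑ˡ n₁ i n₂))

vertex-v : ∀ n₁ n₂ i → vertex n₁ n₂ (vᵢ n₁ i) ≡ inj₁ (inj₂ i)
vertex-v n₁ n₂ i = ≡.trans (≡.cong (map₁ (splitAt n₁)) (Fin.splitAt-↑ˡ (n₁ ℕ.+ n₂) (n₁ ↑ʳ i) n₁))
  (≡.cong inj₁ (Fin.splitAt-↑ʳ n₁ n₂ i))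

vertex-u′ : ∀ n₁ n₂ i → vertex n₁ n₂ (u′ᵢ n₂ i) ≡ inj₂ i
vertex-u′ n₁ n₂ i = ≡.cong (map₁ (splitAt n₁)) (Fin.splitAt-↑ʳ (n₁ ℕ.+ n₂) n₁ i)

-- Degrees as row sums, and the complement

module GraphMatrices {c ℓ} (R : CommutativeRing c ℓ) where

  open CommutativeRing R hiding (zero) renaming (rawRing to raw)
  open Matrices raw
  open import Algebra.Properties.Semiring.Sum semiring
    using (sum; sum-cong-≋; ∑-distrib-+; sum-replicate)
  open import Relation.Binary.Reasoning.Setoid setoid
  open Determinants R
  open MatrixAlgebra R

  diag-I : ∀ {n} (d : Fin n → Carrier) i j → diag d i j ≈ d i * I i j
  diag-I d i j with does (i Fin.≟ j)
  ... | true  = sym (*-identityʳ (d i))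
  ... | false = sym (zeroʳ (d i))

  -- The recursion replaces `f` by `f ∘ suc`, hence the general `f`; degrees are the case `id`,
  -- because `allFin` is `tabulate id`.
  ι-count : ∀ {A : Set} {P : Pred A 0ℓ} (P? : Decidable P) {n} (f : Fin n → A) →
    ι (count P? (tabulate f)) ≈ sum (λ i → if does (P? (f i)) then 1# else 0#)
  ι-count P? {zero}  f = refl
  ι-count P? {suc n} f with does (P? (f zero))
  ... | true  = +-congˡ (ι-count P? (f ∘ suc))
  ... | false = trans (ι-count P? (f ∘ suc)) (sym (+-identityˡ _))

  ι-degree : ∀ {n} (G : Graph (Fin n)) i → ι (degree G i) ≈ sum (A G i)
  ι-degree G i = ι-count (E? G i) id

  ι≈sum-1 : ∀ n → ι n ≈ sum {n} (λ _ → 1#)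
  ι≈sum-1 n = sym (sum-replicate n)

  A-symmetric : ∀ {n} (G : Graph (Fin n)) i j → A G i j ≡ A G j i
  A-symmetric G i j with E? G i j | E? G j i
  ... | yes _ | yes _ = ≡.refl
  ... | no  _ | no  _ = ≡.refl
  ... | yes e | no ¬e = contradiction (E-sym G e) ¬e
  ... | no ¬e | yes e = contradiction (E-sym G e) ¬e

  A-complement : ∀ {n} (G : Graph (Fin n)) i j → A G i j + A (complement G) i j + I i j ≈ 1#
  A-complement G i j with i Fin.≟ j | E? G i j
  ... | yes i≡j | yes e = contradiction e (E-irr G i≡j)
  ... | yes i≡j | no ¬e = trans (+-congʳ (+-identityʳ 0#)) (+-identityˡ 1#)
  ... | no  i≢j | yes e = trans (+-identityʳ _) (+-identityʳ 1#)
  ... | no  i≢j | no ¬e = trans (+-identityʳ _) (+-identityˡ 1#)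

  -- Row sums of A + Ā + I = J. This is the origin of the shift by n₁ - 1 in the formula for the NNS
  -- join.
  degree-complement : ∀ {n} (G : Graph (Fin n)) i →
    ι (degree G i) + ι (degree (complement G) i) + 1# ≈ ι n
  degree-complement {n} G i = begin
    ι (degree G i) + ι (degree (complement G) i) + 1#
      ≈⟨ +-cong (+-cong (ι-degree G i) (ι-degree (complement G) i)) (sym sum-I) ⟩
    sum (A G i) + sum (A (complement G) i) + sum (I i)
      ≈⟨ +-congʳ (∑-distrib-+ (A G i) (A (complement G) i)) ⟨
    sum (λ j → A G i j + A (complement G) i j) + sum (I i)
      ≈⟨ ∑-distrib-+ (λ j → A G i j + A (complement G) i j) (I i) ⟨
    sum (λ j → A G i j + A (complement G) i j + I i j)
      ≈⟨ sum-cong-≋ (A-complement G i) ⟩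
    sum {n} (λ _ → 1#)
      ≈⟨ ι≈sum-1 n ⟨
    ι n ∎
    where
    sum-I : sum (I i) ≈ 1#
    sum-I = begin
      sum (I i)
        ≈⟨ sum-cong-≋ (λ j → trans (reflexive (diag-sym (λ _ → 1#) i j)) (sym (*-identityˡ (I j i)))) ⟩
      sum (λ j → 1# * I j i)
        ≈⟨ sum-*-diag (λ _ → 1#) (λ _ → 1#) i ⟩
      1# * 1#
        ≈⟨ *-identityˡ 1# ⟩
      1# ∎

-- NSJoin G₁ G₂ and NNSJoin G₁ G₂ are the cases K = G₁ and K = complement G₁.
module SplittingJoin {c ℓ} (R : CommutativeRing c ℓ) {n₁ n₂}
  (G₁ : Graph (Fin n₁)) (G₂ : Graph (Fin n₂)) (K : Graph (Fin n₁)) where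

  open CommutativeRing R hiding (zero) renaming (rawRing to raw)
  open Matrices raw
  open import Algebra.Properties.Ring ring using (-0#≈0#)
  open import Algebra.Properties.Semiring.Sum semiring using (sum; sum-cong-≋)
  open import Relation.Binary.Reasoning.Setoid setoid
  open Determinants R
  open MatrixAlgebra R
  open BlockMatrices R
  open GraphMatrices R
  open IntegerRingSolver R

  -- For both choices of `K` this unfolds to the join in question: the decision procedure of
  -- `complement G₁` is the one that `NNSJoin` passes to `splittingJoin`.
  H : Graph (Fin (n₁ ℕ.+ n₂ ℕ.+ n₁))
  H = pullback (vertex n₁ n₂) (splittingJoin G₁ G₂ (E? K))

  private
    a : (s t : (Fin n₁ ⊎ Fin n₂) ⊎ Fin n₁) → Carrier
    a s t = if does (E? (splittingJoin G₁ G₂ (E? K)) s t) then 1# else 0#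

    A-H : ∀ {i j s t} → vertex n₁ n₂ i ≡ s → vertex n₁ n₂ j ≡ t → A H i j ≡ a s t
    A-H ≡.refl ≡.refl = ≡.refl

    u = uᵢ {n₁} n₂
    v = vᵢ n₁ {n₂}
    u′ = u′ᵢ {n₁} n₂
    vertex-at-u = vertex-u n₁ n₂
    vertex-at-v = vertex-v n₁ n₂
    vertex-at-u′ = vertex-u′ n₁ n₂

  degree-H : ∀ {i s} → vertex n₁ n₂ i ≡ s → ι (degree H i) ≈
    sum (λ j → a s (inj₁ (inj₁ j))) + sum (λ j → a s (inj₁ (inj₂ j))) + sum (λ j → a s (inj₂ j))
  degree-H {i} {s} i≡s = begin
    ι (degree H i)
      ≈⟨ ι-degree H i ⟩
    sum (A H i)
      ≈⟨ sum-↑ (n₁ ℕ.+ n₂) (A H i) ⟩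
    sum (λ j → A H i (j ↑ˡ n₁)) + sum (λ j → A H i (u′ j))
      ≈⟨ +-congʳ (sum-↑ n₁ (λ j → A H i (j ↑ˡ n₁))) ⟩
    sum (λ j → A H i (u j)) + sum (λ j → A H i (v j)) + sum (λ j → A H i (u′ j))
      ≈⟨ +-cong (+-cong
          (sum-cong-≋ λ j → reflexive (A-H i≡s (vertex-at-u j)))
          (sum-cong-≋ λ j → reflexive (A-H i≡s (vertex-at-v j))))
          (sum-cong-≋ λ j → reflexive (A-H i≡s (vertex-at-u′ j))) ⟩
    sum (λ j → a s (inj₁ (inj₁ j))) + sum (λ j → a s (inj₁ (inj₂ j))) + sum (λ j → a s (inj₂ j)) ∎

  degree-u : ∀ i → ι (degree H (u i)) ≈ ι (degree G₁ i) + ι n₂ + ι (degree K i)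
  degree-u i = begin
    ι (degree H (u i))
      ≈⟨ degree-H (vertex-at-u i) ⟩
    sum (A G₁ i) + sum {n₂} (λ _ → 1#) + sum (λ j → A K j i)
      -- The copies adjacent to uᵢ are counted by a column of `A K`, which is a row by symmetry.
      ≈⟨ +-cong (+-cong (sym (ι-degree G₁ i)) (sym (ι≈sum-1 n₂)))
           (trans (sum-cong-≋ λ j → reflexive (A-symmetric K j i)) (sym (ι-degree K i))) ⟩
    ι (degree G₁ i) + ι n₂ + ι (degree K i) ∎

  degree-v : ∀ i → ι (degree H (v i)) ≈ ι n₁ + ι (degree G₂ i)
  degree-v i = begin
    ι (degree H (v i))
      ≈⟨ degree-H (vertex-at-v i) ⟩
    sum {n₁} (λ _ → 1#) + sum (A G₂ i) + sum {n₁} (λ _ → 0#)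
      ≈⟨ +-cong (+-cong (sym (ι≈sum-1 n₁)) (sym (ι-degree G₂ i))) (sum-0 {n₁} λ _ → refl) ⟩
    ι n₁ + ι (degree G₂ i) + 0#
      ≈⟨ +-identityʳ _ ⟩
    ι n₁ + ι (degree G₂ i) ∎

  degree-u′ : ∀ i → ι (degree H (u′ i)) ≈ ι (degree K i)
  degree-u′ i = begin
    ι (degree H (u′ i))
      ≈⟨ degree-H (vertex-at-u′ i) ⟩
    sum (A K i) + sum {n₂} (λ _ → 0#) + sum {n₁} (λ _ → 0#)
      ≈⟨ +-cong (+-congˡ (sum-0 {n₂} λ _ → refl)) (sum-0 {n₁} λ _ → refl) ⟩
    sum (A K i) + 0# + 0#
      ≈⟨ trans (+-identityʳ _) (+-identityʳ _) ⟩
    sum (A K i)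
      ≈⟨ ι-degree K i ⟨
    ι (degree K i) ∎

  u-injective : ∀ {i j} → u i ≡ u j → i ≡ j
  u-injective = Fin.↑ˡ-injective n₂ _ _ ∘ Fin.↑ˡ-injective n₁ _ _

  v-injective : ∀ {i j} → v i ≡ v j → i ≡ j
  v-injective = Fin.↑ʳ-injective n₁ _ _ ∘ Fin.↑ˡ-injective n₁ _ _

  u′-injective : ∀ {i j} → u′ i ≡ u′ j → i ≡ j
  u′-injective = Fin.↑ʳ-injective (n₁ ℕ.+ n₂) _ _

  u≢v : ∀ i j → u i ≢ v j
  u≢v i j = ↑ˡ≢↑ʳ ∘ Fin.↑ˡ-injective n₁ _ _

  module _ (y : Carrier) where

    Mʸ : Matrix (n₁ ℕ.+ n₂ ℕ.+ n₁) (n₁ ℕ.+ n₂ ℕ.+ n₁)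
    Mʸ = y • I ⊟ Q H

    M-entry : ∀ i j {s t d δ} → vertex n₁ n₂ i ≡ s → vertex n₁ n₂ j ≡ t →
      ι (degree H i) ≈ d → I i j ≡ δ → Mʸ i j ≈ y * δ + - (d * δ + a s t)
    M-entry i j i≡s j≡t d≈ δ≡ = +-cong (*-congˡ (reflexive δ≡)) (-‿cong (+-cong
      (trans (diag-I (λ i → ι (degree H i)) i j) (*-cong d≈ (reflexive δ≡))) (reflexive (A-H i≡s j≡t))))

    M-off : ∀ i j {s t} → vertex n₁ n₂ i ≡ s → vertex n₁ n₂ j ≡ t → i ≢ j → Mʸ i j ≈ - a s t
    M-off i j {s} {t} i≡s j≡t i≢j = begin
      Mʸ i j
        ≈⟨ M-entry i j i≡s j≡t refl (diag-≢ (λ _ → 1#) i≢j) ⟩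
      y * 0# + - (ι (degree H i) * 0# + a s t)
        ≈⟨ +-cong (zeroʳ y) (-‿cong (trans (+-congʳ (zeroʳ _)) (+-identityˡ _))) ⟩
      0# + - a s t
        ≈⟨ +-identityˡ _ ⟩
      - a s t ∎

    -- The three matrices are fixed only up to entrywise equality, because the theorem takes
    -- inverses of particular expressions: for the NNS join, X is written with `D G₁` although it
    -- arises with the degrees of the complement.
    det-splittingJoin : {X Z : Matrix n₁ n₁} {Y : Matrix n₂ n₂}
      (X-inv : Invertible X) (Y-inv : Invertible Y) (Z-inv : Invertible Z) →
      X ≋ y • I ⊟ D K →
      Y ≋ (y + - ι n₁) • I ⊟ Q G₂ →
      (∀ i j → Z i j + (A K ⊗ X-inv ⁻¹ ⊗ A K) i j
        ≈ y * I i j + - ((ι (degree G₁ i) + ι n₂ + ι (degree K i)) * I i j + A G₁ i j)) →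
      det Mʸ ≈ det Y * det X * det Z * (1# + - (entrySum (Y-inv ⁻¹) * entrySum (Z-inv ⁻¹)))
    det-splittingJoin {X} {Z} {Y} X-inv Y-inv Z-inv X≋ Y≋ Z≋ = det-join n₁ n₂ Mʸ X-inv Y-inv Z-inv
      (λ i j → begin
        Mʸ (u′ i) (u′ j)
          ≈⟨ M-entry (u′ i) (u′ j) (vertex-at-u′ i) (vertex-at-u′ j) (degree-u′ i) (I-reindex u′ u′-injective i j) ⟩
        y * I i j + - (ι (degree K i) * I i j + 0#)
          ≈⟨ +-congˡ (-‿cong (trans (+-identityʳ _) (sym (diag-I (λ i → ι (degree K i)) i j)))) ⟩
        y * I i j + - D K i j
          ≈⟨ X≋ i j ⟨
        X i j ∎)
      (λ i j → begin
        Mʸ (v i) (v j)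
          ≈⟨ M-entry (v i) (v j) (vertex-at-v i) (vertex-at-v j) (degree-v i) (I-reindex v v-injective i j) ⟩
        y * I i j + - ((ι n₁ + ι (degree G₂ i)) * I i j + A G₂ i j)
          ≈⟨ solve 5 (λ y δ n d α → y :* δ :+ :- ((n :+ d) :* δ :+ α) := (y :+ :- n) :* δ :+ :- (d :* δ :+ α))
               refl y (I i j) (ι n₁) (ι (degree G₂ i)) (A G₂ i j) ⟩
        (y + - ι n₁) * I i j + - (ι (degree G₂ i) * I i j + A G₂ i j)
          ≈⟨ +-congˡ (-‿cong (+-congʳ (diag-I (λ i → ι (degree G₂ i)) i j))) ⟨
        (y + - ι n₁) * I i j + - Q G₂ i j
          ≈⟨ Y≋ i j ⟨
        Y i j ∎)
      (λ i j → trans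
        (M-entry (u i) (u j) (vertex-at-u i) (vertex-at-u j) (degree-u i) (I-reindex u u-injective i j))
        (sym (Z≋ i j)))
      (λ i j → M-off (u i) (v j) (vertex-at-u i) (vertex-at-v j) (u≢v i j))
      (λ i j → M-off (v i) (u j) (vertex-at-v i) (vertex-at-u j) (u≢v j i ∘ ≡.sym))
      (λ i j → trans (M-off (u i) (u′ j) (vertex-at-u i) (vertex-at-u′ j) ↑ˡ≢↑ʳ)
        (-‿cong (reflexive (A-symmetric K j i))))
      (λ i j → trans (M-off (v i) (u′ j) (vertex-at-v i) (vertex-at-u′ j) ↑ˡ≢↑ʳ) -0#≈0#)
      (λ i j → M-off (u′ i) (u j) (vertex-at-u′ i) (vertex-at-u j) (↑ˡ≢↑ʳ ∘ ≡.sym))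
      (λ i j → trans (M-off (u′ i) (v j) (vertex-at-u′ i) (vertex-at-v j) (↑ˡ≢↑ʳ ∘ ≡.sym)) -0#≈0#)

-- The two determinant formulas over a commutative ring

module JoinCharacteristicPolynomials {c ℓ} (R : CommutativeRing c ℓ) (y : CommutativeRing.Carrier R)
  {n₁ n₂} (G₁ : Graph (Fin n₁)) (G₂ : Graph (Fin n₂)) where

  open CommutativeRing R hiding (zero) renaming (rawRing to raw)
  open Matrices raw
  open import Relation.Binary.Reasoning.Setoid setoid
  open Determinants R using (det-cong)
  open GraphMatrices R
  open SplittingJoin R G₁ G₂
  open IntegerRingSolver R

  private
    Ā : Matrix n₁ n₁
    Ā = A (complement G₁)

    a₁ : Carrier
    a₁ = y + - ι n₁ + 1#

    b₁ : Carrier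
    b₁ = y + - ι n₁ + - ι n₂ + 1#

    -- The theorem brackets the same matrix Z in two ways: term by term in the determinant, and as a
    -- pencil minus one sum in the coronal.
    subtract-sum : ∀ p q d s → p + - q + d + - s ≈ p + - (q + - d + s)
    subtract-sum = solve 4 (λ p q d s → p :+ :- q :+ d :+ :- s := p :+ :- (q :+ :- d :+ s)) refl

    subtract-sum′ : ∀ p q d s → p + - q + - d + - s ≈ p + - (q + d + s)
    subtract-sum′ = solve 4 (λ p q d s → p :+ :- q :+ :- d :+ :- s := p :+ :- (q :+ d :+ s)) refl

  det-NNSJoin : (X : Invertible (a₁ • I ⊞ D G₁)) (Y : Invertible ((y + - ι n₁) • I ⊟ Q G₂))
    (Z : Invertible (b₁ • I ⊟ (Q G₁ ⊟ D G₁ ⊞ Ā ⊗ X ⁻¹ ⊗ Ā))) →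
    det (y • I ⊟ Q (NNSJoin G₁ G₂))
      ≈ det ((y + - ι n₁) • I ⊟ Q G₂) * det (a₁ • I ⊞ D G₁)
        * det (b₁ • I ⊟ Q G₁ ⊞ D G₁ ⊟ Ā ⊗ X ⁻¹ ⊗ Ā)
        * (1# + - (Γ (Q G₂) (y + - ι n₁) Y * Γ (Q G₁ ⊟ D G₁ ⊞ Ā ⊗ X ⁻¹ ⊗ Ā) b₁ Z))
  det-NNSJoin X Y Z = trans
    (det-splittingJoin (complement G₁) y X Y Z X≋ (λ _ _ → refl) Z≋)
    (*-congʳ (*-congˡ (det-cong λ i j →
      sym (subtract-sum (b₁ * I i j) (Q G₁ i j) (D G₁ i j) ((Ā ⊗ X ⁻¹ ⊗ Ā) i j)))))
    where
    d k : Fin n₁ → Carrier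
    d i = ι (degree G₁ i)
    k i = ι (degree (complement G₁) i)

    X≋ : a₁ • I ⊞ D G₁ ≋ y • I ⊟ D (complement G₁)
    X≋ i j = begin
      (y + - ι n₁ + 1#) * I i j + D G₁ i j
        -- Substituting n₁ = d + k + 1 turns the diagonal entry y - n₁ + 1 + d into y - k, where k
        -- is the degree of the copy u′ᵢ.
        ≈⟨ +-cong (*-congʳ (+-congʳ (+-congˡ (-‿cong (sym (degree-complement G₁ i)))))) (diag-I d i j) ⟩
      (y + - (d i + k i + 1#) + 1#) * I i j + d i * I i j
        ≈⟨ solve 5 (λ y d k o δ → (y :+ :- (d :+ k :+ o) :+ o) :* δ :+ d :* δ := y :* δ :+ :- (k :* δ))
             refl y (d i) (k i) 1# (I i j) ⟩
      y * I i j + - (k i * I i j)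
        ≈⟨ +-congˡ (-‿cong (diag-I k i j)) ⟨
      y * I i j + - D (complement G₁) i j ∎

    Z≋ : ∀ i j → (b₁ • I ⊟ (Q G₁ ⊟ D G₁ ⊞ Ā ⊗ X ⁻¹ ⊗ Ā)) i j + (Ā ⊗ X ⁻¹ ⊗ Ā) i j
      ≈ y * I i j + - ((d i + ι n₂ + k i) * I i j + A G₁ i j)
    Z≋ i j = begin
      (y + - ι n₁ + - ι n₂ + 1#) * I i j
        + - (D G₁ i j + A G₁ i j + - D G₁ i j + (Ā ⊗ X ⁻¹ ⊗ Ā) i j) + (Ā ⊗ X ⁻¹ ⊗ Ā) i j
        -- The same substitution turns `b₁` into y - (d + n₂ + k), and d + n₂ + k is the degree of
        -- uᵢ. Subtracting `D G₁` from `Q G₁` leaves the adjacency part.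
        ≈⟨ +-congʳ (+-congʳ (*-congʳ (+-congʳ (+-congʳ (+-congˡ (-‿cong (sym (degree-complement G₁ i)))))))) ⟩
      (y + - (d i + k i + 1#) + - ι n₂ + 1#) * I i j
        + - (D G₁ i j + A G₁ i j + - D G₁ i j + (Ā ⊗ X ⁻¹ ⊗ Ā) i j) + (Ā ⊗ X ⁻¹ ⊗ Ā) i j
        ≈⟨ solve 9 (λ y d k o m δ e α s →
             (y :+ :- (d :+ k :+ o) :+ :- m :+ o) :* δ :+ :- (e :+ α :+ :- e :+ s) :+ s
               := y :* δ :+ :- ((d :+ m :+ k) :* δ :+ α))
             refl y (d i) (k i) 1# (ι n₂) (I i j) (D G₁ i j) (A G₁ i j) ((Ā ⊗ X ⁻¹ ⊗ Ā) i j) ⟩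
      y * I i j + - ((d i + ι n₂ + k i) * I i j + A G₁ i j) ∎

  det-NSJoin : (X : Invertible (y • I ⊟ D G₁)) (Y : Invertible ((y + - ι n₁) • I ⊟ Q G₂))
    (Z : Invertible ((y + - ι n₂) • I ⊟ (Q G₁ ⊞ D G₁ ⊞ A G₁ ⊗ X ⁻¹ ⊗ A G₁))) →
    det (y • I ⊟ Q (NSJoin G₁ G₂))
      ≈ det ((y + - ι n₁) • I ⊟ Q G₂) * det (y • I ⊟ D G₁)
        * det ((y + - ι n₂) • I ⊟ Q G₁ ⊟ D G₁ ⊟ A G₁ ⊗ X ⁻¹ ⊗ A G₁)
        * (1# + - (Γ (Q G₂) (y + - ι n₁) Y * Γ (Q G₁ ⊞ D G₁ ⊞ A G₁ ⊗ X ⁻¹ ⊗ A G₁) (y + - ι n₂) Z))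
  det-NSJoin X Y Z = trans
    (det-splittingJoin G₁ y X Y Z (λ _ _ → refl) (λ _ _ → refl) Z≋)
    (*-congʳ (*-congˡ (det-cong λ i j →
      sym (subtract-sum′ ((y + - ι n₂) * I i j) (Q G₁ i j) (D G₁ i j) ((A G₁ ⊗ X ⁻¹ ⊗ A G₁) i j)))))
    where
    d : Fin n₁ → Carrier
    d i = ι (degree G₁ i)

    Z≋ : ∀ i j → ((y + - ι n₂) • I ⊟ (Q G₁ ⊞ D G₁ ⊞ A G₁ ⊗ X ⁻¹ ⊗ A G₁)) i j + (A G₁ ⊗ X ⁻¹ ⊗ A G₁) i j
      ≈ y * I i j + - ((d i + ι n₂ + d i) * I i j + A G₁ i j)
    Z≋ i j = begin
      (y + - ι n₂) * I i j
        + - (D G₁ i j + A G₁ i j + D G₁ i j + (A G₁ ⊗ X ⁻¹ ⊗ A G₁) i j) + (A G₁ ⊗ X ⁻¹ ⊗ A G₁) i j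
        -- The degree of uᵢ is d + n₂ + d, since its neighbours among the copies number d as well;
        -- the two summands d are those of `Q G₁` and of the extra `D G₁`.
        ≈⟨ +-congʳ (+-congˡ (-‿cong (+-congʳ (+-cong (+-congʳ (diag-I d i j)) (diag-I d i j))))) ⟩
      (y + - ι n₂) * I i j
        + - (d i * I i j + A G₁ i j + d i * I i j + (A G₁ ⊗ X ⁻¹ ⊗ A G₁) i j) + (A G₁ ⊗ X ⁻¹ ⊗ A G₁) i j
        ≈⟨ solve 6 (λ y d m δ α s →
             (y :+ :- m) :* δ :+ :- (d :* δ :+ α :+ d :* δ :+ s) :+ s := y :* δ :+ :- ((d :+ m :+ d) :* δ :+ α))
             refl y (d i) (ι n₂) (I i j) (A G₁ i j) ((A G₁ ⊗ X ⁻¹ ⊗ A G₁) i j) ⟩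
      y * I i j + - ((d i + ι n₂ + d i) * I i j + A G₁ i j) ∎

-- The field of rational functions

open import Defs using
  ( Poly; coeff; _≈ₚ_; _+ₚ_; _*ₚ_; -ₚ_; NonZeroₚ; coeff-+ₚ; coeff-map*; coeff-∷*; *ₚ-nonZero
  ; RatFun; ℚ⟨x⟩)

open +-*-Solver using () renaming (solve to solveℤ; _:+_ to _:+ℤ_; _:*_ to _:*ℤ_; _:=_ to _:=ℤ_)

coeff--ₚ : ∀ p k → coeff (-ₚ p) k ≡ ℤ.- coeff p k
coeff--ₚ []      k       = ≡.refl
coeff--ₚ (a ∷ p) zero    = ≡.refl
coeff--ₚ (a ∷ p) (suc k) = coeff--ₚ p k

-- A wrapper from which the two polynomials can be inferred: _≈ₚ_ unfolds to an equation between
-- coefficients, which does not determine them.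
record _≃_ (p q : Poly) : Set where
  constructor pointwise
  field
    at : p ≈ₚ q

open _≃_

infix 4 _≃_

≃-sym : ∀ {p q} → p ≃ q → q ≃ p
≃-sym p≈q .at k = ≡.sym (at p≈q k)

≃-trans : ∀ {p q r} → p ≃ q → q ≃ r → p ≃ r
≃-trans p≈q q≈r .at k = ≡.trans (at p≈q k) (at q≈r k)

∷-cong : ∀ {a} {p q} → p ≃ q → a ∷ p ≃ a ∷ q
∷-cong p≈q .at zero    = ≡.refl
∷-cong p≈q .at (suc k) = at p≈q k

0∷[] : 0ℤ ∷ [] ≃ []
0∷[] .at zero    = ≡.refl
0∷[] .at (suc k) = ≡.refl

+ₚ-cong : ∀ {p p′ q q′} → p ≃ p′ → q ≃ q′ → p +ₚ q ≃ p′ +ₚ q′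
+ₚ-cong {p} {p′} {q} {q′} p≈p′ q≈q′ .at k =
  ≡.trans (coeff-+ₚ p q k) (≡.trans (≡.cong₂ ℤ._+_ (at p≈p′ k) (at q≈q′ k)) (≡.sym (coeff-+ₚ p′ q′ k)))

+ₚ-assoc : ∀ p q r → (p +ₚ q) +ₚ r ≃ p +ₚ (q +ₚ r)
+ₚ-assoc p q r .at k = begin
  coeff ((p +ₚ q) +ₚ r) k                       ≡⟨ coeff-+ₚ (p +ₚ q) r k ⟩
  coeff (p +ₚ q) k ℤ.+ coeff r k                ≡⟨ ≡.cong (ℤ._+ coeff r k) (coeff-+ₚ p q k) ⟩
  coeff p k ℤ.+ coeff q k ℤ.+ coeff r k         ≡⟨ ℤ.+-assoc (coeff p k) _ _ ⟩
  coeff p k ℤ.+ (coeff q k ℤ.+ coeff r k)       ≡⟨ ≡.cong (λ c → coeff p k ℤ.+ c) (coeff-+ₚ q r k) ⟨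
  coeff p k ℤ.+ coeff (q +ₚ r) k                ≡⟨ coeff-+ₚ p (q +ₚ r) k ⟨
  coeff (p +ₚ (q +ₚ r)) k                       ∎
  where open ≡.≡-Reasoning

+ₚ-comm : ∀ p q → p +ₚ q ≃ q +ₚ p
+ₚ-comm p q .at k = ≡.trans (coeff-+ₚ p q k) (≡.trans (ℤ.+-comm (coeff p k) _) (≡.sym (coeff-+ₚ q p k)))

-ₚ-inverseʳ : ∀ p → p +ₚ (-ₚ p) ≃ []
-ₚ-inverseʳ p .at k = ≡.trans (coeff-+ₚ p (-ₚ p) k)
  (≡.trans (≡.cong (λ c → coeff p k ℤ.+ c) (coeff--ₚ p k)) (ℤ.+-inverseʳ (coeff p k)))

-ₚ-cong : ∀ {p q} → p ≃ q → -ₚ p ≃ -ₚ q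
-ₚ-cong {p} {q} p≈q .at k = ≡.trans (coeff--ₚ p k) (≡.trans (≡.cong ℤ.-_ (at p≈q k)) (≡.sym (coeff--ₚ q k)))

*ₚ-congˡ : ∀ p {q r} → q ≃ r → p *ₚ q ≃ p *ₚ r
*ₚ-congˡ []      q≈r .at k = ≡.refl
*ₚ-congˡ (a ∷ p) {q} {r} q≈r .at k = ≡.trans (coeff-∷* a p q k)
  (≡.trans (≡.cong₂ (λ b c → a ℤ.* b ℤ.+ c) (at q≈r k) (at (∷-cong (*ₚ-congˡ p q≈r)) k)) (≡.sym (coeff-∷* a p r k)))

-- `_*ₚ_` recurses on its left factor. Unfolding the right factor as well is what makes
-- commutativity an induction.
*ₚ-∷ : ∀ p b q → p *ₚ (b ∷ q) ≃ map (b ℤ.*_) p +ₚ (0ℤ ∷ p *ₚ q)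
*ₚ-∷ []      b q = ≃-sym 0∷[]
*ₚ-∷ (a ∷ p) b q .at zero    = ≡.cong (ℤ._+ 0ℤ) (ℤ.*-comm a b)
*ₚ-∷ (a ∷ p) b q .at (suc k) = begin
  coeff ((a ∷ p) *ₚ (b ∷ q)) (suc k)
    ≡⟨ coeff-∷* a p (b ∷ q) (suc k) ⟩
  a ℤ.* coeff q k ℤ.+ coeff (p *ₚ (b ∷ q)) k
    ≡⟨ ≡.cong (λ c → a ℤ.* coeff q k ℤ.+ c) (at (*ₚ-∷ p b q) k) ⟩
  a ℤ.* coeff q k ℤ.+ coeff (map (b ℤ.*_) p +ₚ (0ℤ ∷ p *ₚ q)) k
    ≡⟨ ≡.cong (λ c → a ℤ.* coeff q k ℤ.+ c) (coeff-+ₚ (map (b ℤ.*_) p) _ k) ⟩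
  a ℤ.* coeff q k ℤ.+ (coeff (map (b ℤ.*_) p) k ℤ.+ coeff (0ℤ ∷ p *ₚ q) k)
    ≡⟨ solveℤ 3 (λ x y z → x :+ℤ (y :+ℤ z) :=ℤ y :+ℤ (x :+ℤ z)) ≡.refl
         (a ℤ.* coeff q k) (coeff (map (b ℤ.*_) p) k) (coeff (0ℤ ∷ p *ₚ q) k) ⟩
  coeff (map (b ℤ.*_) p) k ℤ.+ (a ℤ.* coeff q k ℤ.+ coeff (0ℤ ∷ p *ₚ q) k)
    ≡⟨ ≡.cong (λ c → coeff (map (b ℤ.*_) p) k ℤ.+ c) (coeff-∷* a p q k) ⟨
  coeff (map (b ℤ.*_) p) k ℤ.+ coeff ((a ∷ p) *ₚ q) k
    ≡⟨ coeff-+ₚ (map (b ℤ.*_) p) ((a ∷ p) *ₚ q) k ⟨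
  coeff (map (b ℤ.*_) p +ₚ (a ∷ p) *ₚ q) k ∎
  where open ≡.≡-Reasoning

*ₚ-zeroʳ : ∀ p → p *ₚ [] ≃ []
*ₚ-zeroʳ []      = pointwise λ _ → ≡.refl
*ₚ-zeroʳ (a ∷ p) = ≃-trans (∷-cong (*ₚ-zeroʳ p)) 0∷[]

*ₚ-comm : ∀ p q → p *ₚ q ≃ q *ₚ p
*ₚ-comm []      q = ≃-sym (*ₚ-zeroʳ q)
*ₚ-comm (a ∷ p) q = ≃-trans
  (+ₚ-cong {map (a ℤ.*_) q} {map (a ℤ.*_) q} (pointwise λ _ → ≡.refl) (∷-cong (*ₚ-comm p q)))
  (≃-sym (*ₚ-∷ q a p))

*ₚ-congʳ : ∀ {p q} r → p ≃ q → p *ₚ r ≃ q *ₚ r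
*ₚ-congʳ {p} {q} r p≈q = ≃-trans (*ₚ-comm p r) (≃-trans (*ₚ-congˡ r p≈q) (*ₚ-comm r q))

*ₚ-distribˡ-+ₚ : ∀ p q r → p *ₚ (q +ₚ r) ≃ p *ₚ q +ₚ p *ₚ r
*ₚ-distribˡ-+ₚ []      q r .at k = ≡.refl
*ₚ-distribˡ-+ₚ (a ∷ p) q r .at k = begin
  coeff ((a ∷ p) *ₚ (q +ₚ r)) k
    ≡⟨ coeff-∷* a p (q +ₚ r) k ⟩
  a ℤ.* coeff (q +ₚ r) k ℤ.+ coeff (0ℤ ∷ p *ₚ (q +ₚ r)) k
    ≡⟨ ≡.cong₂ (λ b c → a ℤ.* b ℤ.+ c) (coeff-+ₚ q r k) (tail k) ⟩
  a ℤ.* (coeff q k ℤ.+ coeff r k) ℤ.+ (coeff (0ℤ ∷ p *ₚ q) k ℤ.+ coeff (0ℤ ∷ p *ₚ r) k)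
    ≡⟨ solveℤ 5 (λ a x y u v → a :*ℤ (x :+ℤ y) :+ℤ (u :+ℤ v) :=ℤ (a :*ℤ x :+ℤ u) :+ℤ (a :*ℤ y :+ℤ v))
         ≡.refl a (coeff q k) (coeff r k) _ _ ⟩
  (a ℤ.* coeff q k ℤ.+ coeff (0ℤ ∷ p *ₚ q) k) ℤ.+ (a ℤ.* coeff r k ℤ.+ coeff (0ℤ ∷ p *ₚ r) k)
    ≡⟨ ≡.cong₂ ℤ._+_ (coeff-∷* a p q k) (coeff-∷* a p r k) ⟨
  coeff ((a ∷ p) *ₚ q) k ℤ.+ coeff ((a ∷ p) *ₚ r) k
    ≡⟨ coeff-+ₚ ((a ∷ p) *ₚ q) ((a ∷ p) *ₚ r) k ⟨
  coeff ((a ∷ p) *ₚ q +ₚ (a ∷ p) *ₚ r) k ∎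
  where
  open ≡.≡-Reasoning
  tail : ∀ k → coeff (0ℤ ∷ p *ₚ (q +ₚ r)) k ≡ coeff (0ℤ ∷ p *ₚ q) k ℤ.+ coeff (0ℤ ∷ p *ₚ r) k
  tail zero    = ≡.refl
  tail (suc k) = ≡.trans (at (*ₚ-distribˡ-+ₚ p q r) k) (coeff-+ₚ (p *ₚ q) (p *ₚ r) k)

*ₚ-distribʳ-+ₚ : ∀ p q r → (q +ₚ r) *ₚ p ≃ q *ₚ p +ₚ r *ₚ p
*ₚ-distribʳ-+ₚ p q r = ≃-trans (*ₚ-comm (q +ₚ r) p) (≃-trans (*ₚ-distribˡ-+ₚ p q r)
  (+ₚ-cong (*ₚ-comm p q) (*ₚ-comm p r)))

map-*ₚ : ∀ a p q → map (a ℤ.*_) p *ₚ q ≃ map (a ℤ.*_) (p *ₚ q)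
map-*ₚ a []      q .at k = ≡.refl
map-*ₚ a (b ∷ p) q .at k = begin
  coeff ((a ℤ.* b ∷ map (a ℤ.*_) p) *ₚ q) k
    ≡⟨ coeff-∷* (a ℤ.* b) (map (a ℤ.*_) p) q k ⟩
  a ℤ.* b ℤ.* coeff q k ℤ.+ coeff (0ℤ ∷ map (a ℤ.*_) p *ₚ q) k
    ≡⟨ ≡.cong (λ c → a ℤ.* b ℤ.* coeff q k ℤ.+ c) (tail k) ⟩
  a ℤ.* b ℤ.* coeff q k ℤ.+ a ℤ.* coeff (0ℤ ∷ p *ₚ q) k
    ≡⟨ solveℤ 4 (λ a b x y → a :*ℤ b :*ℤ x :+ℤ a :*ℤ y :=ℤ a :*ℤ (b :*ℤ x :+ℤ y)) ≡.refl a b (coeff q k) _ ⟩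
  a ℤ.* (b ℤ.* coeff q k ℤ.+ coeff (0ℤ ∷ p *ₚ q) k)
    ≡⟨ ≡.cong (a ℤ.*_) (coeff-∷* b p q k) ⟨
  a ℤ.* coeff ((b ∷ p) *ₚ q) k
    ≡⟨ coeff-map* a ((b ∷ p) *ₚ q) k ⟨
  coeff (map (a ℤ.*_) ((b ∷ p) *ₚ q)) k ∎
  where
  open ≡.≡-Reasoning
  tail : ∀ k → coeff (0ℤ ∷ map (a ℤ.*_) p *ₚ q) k ≡ a ℤ.* coeff (0ℤ ∷ p *ₚ q) k
  tail zero    = ≡.sym (ℤ.*-zeroʳ a)
  tail (suc k) = ≡.trans (at (map-*ₚ a p q) k) (coeff-map* a (p *ₚ q) k)

0∷-*ₚ : ∀ p q → (0ℤ ∷ p) *ₚ q ≃ 0ℤ ∷ p *ₚ q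
0∷-*ₚ p q .at k = ≡.trans (coeff-∷* 0ℤ p q k) (ℤ.+-identityˡ _)

*ₚ-assoc : ∀ p q r → (p *ₚ q) *ₚ r ≃ p *ₚ (q *ₚ r)
*ₚ-assoc []      q r = pointwise λ _ → ≡.refl
*ₚ-assoc (a ∷ p) q r = ≃-trans (*ₚ-distribʳ-+ₚ r (map (a ℤ.*_) q) (0ℤ ∷ p *ₚ q))
  (+ₚ-cong (map-*ₚ a q r)
    (≃-trans (0∷-*ₚ (p *ₚ q) r) (∷-cong (*ₚ-assoc p q r))))

*ₚ-identityˡ : ∀ p → (1ℤ ∷ []) *ₚ p ≃ p
*ₚ-identityˡ p .at k = ≡.trans (coeff-∷* 1ℤ [] p k)
  (≡.trans (≡.cong₂ ℤ._+_ (ℤ.*-identityˡ (coeff p k)) (at 0∷[] k)) (ℤ.+-identityʳ _))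

polynomialRing : CommutativeRing 0ℓ 0ℓ
polynomialRing = record
  { Carrier = Poly ; _≈_ = _≃_ ; _+_ = _+ₚ_ ; _*_ = _*ₚ_ ; -_ = -ₚ_ ; 0# = [] ; 1# = 1ℤ ∷ []
  ; isCommutativeRing = record
    { isRing = record
      { +-isAbelianGroup = record
        { isGroup = record
          { isMonoid = record
            { isSemigroup = record
              { isMagma = record
                { isEquivalence = record { refl = pointwise λ _ → ≡.refl ; sym = ≃-sym ; trans = ≃-trans }
                ; ∙-cong = +ₚ-cong
                }
              ; assoc = +ₚ-assoc
              }
            ; identity = (λ _ → pointwise λ _ → ≡.refl) , (λ p → +ₚ-comm p [])
            }
          ; inverse = (λ p → ≃-trans (+ₚ-comm (-ₚ p) p) (-ₚ-inverseʳ p)) , -ₚ-inverseʳ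
          ; ⁻¹-cong = -ₚ-cong
          }
        ; comm = +ₚ-comm
        }
      ; *-cong = λ {p} {q} {r} {s} p≈q r≈s → ≃-trans (*ₚ-congʳ r p≈q) (*ₚ-congˡ q r≈s)
      ; *-assoc = *ₚ-assoc
      ; *-identity = *ₚ-identityˡ , (λ p → ≃-trans (*ₚ-comm p _) (*ₚ-identityˡ p))
      ; distrib = *ₚ-distribˡ-+ₚ , *ₚ-distribʳ-+ₚ
      }
    ; *-comm = *ₚ-comm
    }
  }

-- Cross-multiplied identities behind the laws for fractions

module FractionIdentities {c ℓ} (R : CommutativeRing c ℓ) where

  open CommutativeRing R hiding (zero)
  open import Relation.Binary.Reasoning.Setoid setoid
  open IntegerRingSolver R

  -- From a/b = c/d and c/d = e/k, the equation for a/b and e/k follows only up to the middle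
  -- denominator `d`, which is cancelled afterwards because ℤ[x] has no zero divisors.
  cross-trans : ∀ a b c d e k → a * d ≈ c * b → c * k ≈ e * d → a * k * d ≈ e * b * d
  cross-trans a b c d e k ad≈cb ck≈ed = begin
    a * k * d     ≈⟨ solve 3 (λ a k d → a :* k :* d := a :* d :* k) refl a k d ⟩
    a * d * k     ≈⟨ *-congʳ ad≈cb ⟩
    c * b * k     ≈⟨ solve 3 (λ c b k → c :* b :* k := c :* k :* b) refl c b k ⟩
    c * k * b     ≈⟨ *-congʳ ck≈ed ⟩
    e * d * b     ≈⟨ solve 3 (λ e d b → e :* d :* b := e :* b :* d) refl e d b ⟩
    e * b * d     ∎

  cross-+-cong : ∀ a b a′ b′ c d c′ d′ → a * b′ ≈ a′ * b → c * d′ ≈ c′ * d →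
    (a * d + c * b) * (b′ * d′) ≈ (a′ * d′ + c′ * b′) * (b * d)
  cross-+-cong a b a′ b′ c d c′ d′ e₁ e₂ = begin
    (a * d + c * b) * (b′ * d′)
      ≈⟨ solve 6 (λ a b c d b′ d′ → (a :* d :+ c :* b) :* (b′ :* d′) := a :* b′ :* (d :* d′) :+ c :* d′ :* (b :* b′))
           refl a b c d b′ d′ ⟩
    a * b′ * (d * d′) + c * d′ * (b * b′)
      ≈⟨ +-cong (*-congʳ e₁) (*-congʳ e₂) ⟩
    a′ * b * (d * d′) + c′ * d * (b * b′)
      ≈⟨ solve 6 (λ a b c d b′ d′ → a :* b :* (d :* d′) :+ c :* d :* (b :* b′) := (a :* d′ :+ c :* b′) :* (b :* d))
           refl a′ b c′ d b′ d′ ⟩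
    (a′ * d′ + c′ * b′) * (b * d) ∎

  cross-*-cong : ∀ a b a′ b′ c d c′ d′ → a * b′ ≈ a′ * b → c * d′ ≈ c′ * d →
    a * c * (b′ * d′) ≈ a′ * c′ * (b * d)
  cross-*-cong a b a′ b′ c d c′ d′ e₁ e₂ = begin
    a * c * (b′ * d′)      ≈⟨ solve 4 (λ a c b d → a :* c :* (b :* d) := a :* b :* (c :* d)) refl a c b′ d′ ⟩
    a * b′ * (c * d′)      ≈⟨ *-cong e₁ e₂ ⟩
    a′ * b * (c′ * d)      ≈⟨ solve 4 (λ a c b d → a :* b :* (c :* d) := a :* c :* (b :* d)) refl a′ c′ b d ⟩
    a′ * c′ * (b * d)      ∎

  cross-‿cong : ∀ a b a′ b′ → a * b′ ≈ a′ * b → - a * b′ ≈ - a′ * b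
  cross-‿cong a b a′ b′ e = begin
    - a * b′      ≈⟨ solve 2 (λ a b → :- a :* b := :- (a :* b)) refl a b′ ⟩
    - (a * b′)    ≈⟨ -‿cong e ⟩
    - (a′ * b)    ≈⟨ solve 2 (λ a b → :- a :* b := :- (a :* b)) refl a′ b ⟨
    - a′ * b      ∎

  cross-+-assoc : ∀ a b c d e k →
    ((a * d + c * b) * k + e * (b * d)) * (b * (d * k)) ≈ (a * (d * k) + (c * k + e * d) * b) * (b * d * k)
  cross-+-assoc = solve 6 (λ a b c d e k →
    ((a :* d :+ c :* b) :* k :+ e :* (b :* d)) :* (b :* (d :* k))
      := (a :* (d :* k) :+ (c :* k :+ e :* d) :* b) :* (b :* d :* k)) refl

  cross-+-comm : ∀ a b c d → (a * d + c * b) * (d * b) ≈ (c * b + a * d) * (b * d)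
  cross-+-comm = solve 4 (λ a b c d → (a :* d :+ c :* b) :* (d :* b) := (c :* b :+ a :* d) :* (b :* d)) refl

  cross-+-identityˡ : ∀ a b → (0# * b + a * 1#) * b ≈ a * (1# * b)
  cross-+-identityˡ a b = *-cong
    (trans (+-cong (zeroˡ b) (*-identityʳ a)) (+-identityˡ a)) (sym (*-identityˡ b))

  cross-‿inverseˡ : ∀ a b → (- a * b + a * b) * 1# ≈ 0# * (b * b)
  cross-‿inverseˡ a b = begin
    (- a * b + a * b) * 1#    ≈⟨ *-identityʳ _ ⟩
    - a * b + a * b           ≈⟨ distribʳ b (- a) a ⟨
    (- a + a) * b             ≈⟨ *-congʳ (-‿inverseˡ a) ⟩
    0# * b                    ≈⟨ zeroˡ b ⟩
    0#                        ≈⟨ zeroˡ (b * b) ⟨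
    0# * (b * b)              ∎

  cross-*-assoc : ∀ a b c d e k → a * c * e * (b * (d * k)) ≈ a * (c * e) * (b * d * k)
  cross-*-assoc a b c d e k = *-cong (*-assoc a c e) (sym (*-assoc b d k))

  cross-*-comm : ∀ a b c d → a * c * (d * b) ≈ c * a * (b * d)
  cross-*-comm a b c d = *-cong (*-comm a c) (*-comm d b)

  cross-*-identityˡ : ∀ a b → 1# * a * b ≈ a * (1# * b)
  cross-*-identityˡ a b = trans (*-congʳ (*-comm 1# a)) (*-assoc a 1# b)

  cross-distribʳ : ∀ a b c d e k →
    (c * k + e * d) * a * (d * b * (k * b)) ≈ (c * a * (k * b) + e * a * (d * b)) * (d * k * b)
  cross-distribʳ = solve 6 (λ a b c d e k →
    (c :* k :+ e :* d) :* a :* (d :* b :* (k :* b))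
      := (c :* a :* (k :* b) :+ e :* a :* (d :* b)) :* (d :* k :* b)) refl

open import Algebra.Properties.Ring (CommutativeRing.ring polynomialRing) using (-‿distribˡ-*; x∙y⁻¹≈ε⇒x≈y)

-- `*ₚ-nonZero` only refutes; deciding whether a given coefficient is zero turns it into a positive
-- conclusion.
*ₚ-noZeroDivisors : ∀ p q → NonZeroₚ q → p *ₚ q ≃ [] → p ≃ []
*ₚ-noZeroDivisors p q q≉0 pq≈0 .at k with coeff p k ℤ.≟ 0ℤ
... | yes pₖ≡0 = pₖ≡0
... | no  pₖ≢0 = contradiction (at pq≈0) (*ₚ-nonZero p q (λ p≈0 → pₖ≢0 (p≈0 k)) q≉0)

*ₚ-cancelʳ : ∀ p q r → NonZeroₚ r → p *ₚ r ≃ q *ₚ r → p ≃ q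
*ₚ-cancelʳ p q r r≉0 pr≈qr = x∙y⁻¹≈ε⇒x≈y p q (*ₚ-noZeroDivisors _ r r≉0
  (P.trans (P.distribʳ r p (-ₚ q)) (P.trans (P.+-cong pr≈qr (P.sym (-‿distribˡ-* q r))) (P.-‿inverseʳ (q *ₚ r)))))
  where module P = CommutativeRing polynomialRing

open FractionIdentities polynomialRing
open RatFun

-- Its raw ring is `ℚ⟨x⟩` itself, so results over a general commutative ring speak directly about
-- the matrices of the theorem. The ring laws are collected here; inverses come from `reciprocal`.
rationalFunctionField : CommutativeRing 0ℓ 0ℓ
rationalFunctionField = record
  { Carrier = R.Carrier ; _≈_ = R._≈_ ; _+_ = R._+_ ; _*_ = R._*_ ; -_ = R.-_ ; 0# = R.0# ; 1# = R.1#
  ; isCommutativeRing = record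
    { isRing = record
      { +-isAbelianGroup = record
        { isGroup = record
          { isMonoid = record
            { isSemigroup = record
              { isMagma = record
                { isEquivalence = record
                  { refl  = λ _ → ≡.refl
                  ; sym   = λ f≈g k → ≡.sym (f≈g k)
                  ; trans = λ {f} {g} {h} → trans≈ f g h
                  }
                ; ∙-cong = λ {f} {f′} {g} {g′} → +-cong f f′ g g′
                }
              ; assoc = λ f g h → at (cross-+-assoc (num f) (den f) (num g) (den g) (num h) (den h))
              }
            ; identity = (λ f → at (cross-+-identityˡ (num f) (den f)))
                       , (λ f → trans≈ (f R.+ R.0#) (R.0# R.+ f) f (+-comm f R.0#)
                           (at (cross-+-identityˡ (num f) (den f))))
            }
          ; inverse = -‿inverseˡ
                    , (λ f → trans≈ (f R.+ R.- f) (R.- f R.+ f) R.0# (+-comm f (R.- f)) (-‿inverseˡ f))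
          ; ⁻¹-cong = λ {f} {g} f≈g → at (cross-‿cong (num f) (den f) (num g) (den g) (pointwise f≈g))
          }
        ; comm = +-comm
        }
      ; *-cong = λ {f} {f′} {g} {g′} f≈f′ g≈g′ → at (cross-*-cong
          (num f) (den f) (num f′) (den f′) (num g) (den g) (num g′) (den g′)
          (pointwise f≈f′) (pointwise g≈g′))
      ; *-assoc = λ f g h → at (cross-*-assoc (num f) (den f) (num g) (den g) (num h) (den h))
      ; *-identity = *-identityˡ
                   , (λ f → trans≈ (f R.* R.1#) (R.1# R.* f) f (*-comm f R.1#) (*-identityˡ f))
      ; distrib = (λ f g h → trans≈ (f R.* (g R.+ h)) ((g R.+ h) R.* f) (f R.* g R.+ f R.* h)
                    (*-comm f (g R.+ h))
                    (trans≈ ((g R.+ h) R.* f) (g R.* f R.+ h R.* f) (f R.* g R.+ f R.* h) (distribʳ f g h)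
                      (+-cong (g R.* f) (f R.* g) (h R.* f) (f R.* h) (*-comm g f) (*-comm h f))))
                , distribʳ
      }
    ; *-comm = *-comm
    }
  }
  where
  module R = RawRing ℚ⟨x⟩
  trans≈ : ∀ f g h → f R.≈ g → g R.≈ h → f R.≈ h
  trans≈ f g h f≈g g≈h = at (*ₚ-cancelʳ (num f *ₚ den h) (num h *ₚ den f) (den g) (den≉0 g)
    (cross-trans (num f) (den f) (num g) (den g) (num h) (den h) (pointwise f≈g) (pointwise g≈h)))
  +-cong : ∀ f f′ g g′ → f R.≈ f′ → g R.≈ g′ → f R.+ g R.≈ f′ R.+ g′
  +-cong f f′ g g′ f≈f′ g≈g′ = at (cross-+-cong (num f) (den f) (num f′) (den f′) (num g) (den g) (num g′) (den g′)
      (pointwise f≈f′) (pointwise g≈g′))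
  +-comm : ∀ f g → f R.+ g R.≈ g R.+ f
  +-comm f g = at (cross-+-comm (num f) (den f) (num g) (den g))
  -‿inverseˡ : ∀ f → R.- f R.+ f R.≈ R.0#
  -‿inverseˡ f = at (cross-‿inverseˡ (num f) (den f))
  *-comm : ∀ f g → f R.* g R.≈ g R.* f
  *-comm f g = at (cross-*-comm (num f) (den f) (num g) (den g))
  *-identityˡ : ∀ f → R.1# R.* f R.≈ f
  *-identityˡ f = at (cross-*-identityˡ (num f) (den f))
  distribʳ : ∀ f g h → (g R.+ h) R.* f R.≈ g R.* f R.+ h R.* f
  distribʳ f g h = at (cross-distribʳ (num f) (den f) (num g) (den g) (num h) (den h))

-- Degrees of rational functions

open import Defs
open import Algebra.Properties.CommutativeSemigroup ℕ.+-commutativeSemigroup using (interchange; xy∙z≈xz∙y)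
open import Algebra.Definitions.RawMonoid (RawRing.+-rawMonoid ℚ⟨x⟩) using (sum)
open import Algebra.Definitions.RawSemiring (RawRing.rawSemiring ℚ⟨x⟩) using (_^_)

integerRing : CommutativeRing _ _
integerRing = ℤ.+-*-commutativeRing

module Mℤ = Matrices (CommutativeRing.rawRing integerRing)
open import Algebra.Definitions.RawSemiring (RawRing.rawSemiring (CommutativeRing.rawRing integerRing))
  using () renaming (_^_ to _^ℤ_)
open import Algebra.Definitions.RawMonoid ℤ.+-0-rawMonoid using () renaming (sum to sumℤ)

-- The coefficient `c` may be zero, so `d` is only a bound for the degree. This keeps the notion
-- stable under sums in which top terms cancel.
record Leading (d : ℕ) (c : ℤ) (p : Poly) : Set where
  constructor leading
  field
    coeff-at    : coeff p d ≡ c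
    coeff-above : ∀ k → d ℕ.< k → coeff p k ≡ 0ℤ

open Leading

leading-cast : ∀ {d e a p} → d ≡ e → Leading d a p → Leading e a p
leading-cast ≡.refl l = l

leading-+ : ∀ {d a b} p q → Leading d a p → Leading d b q → Leading d (a ℤ.+ b) (p +ₚ q)
leading-+ {d} p q l m .coeff-at = ≡.trans (coeff-+ₚ p q d) (≡.cong₂ ℤ._+_ (coeff-at l) (coeff-at m))
leading-+ p q l m .coeff-above k d<k =
  ≡.trans (coeff-+ₚ p q k) (≡.cong₂ ℤ._+_ (coeff-above l k d<k) (coeff-above m k d<k))

leading-neg : ∀ {d a} p → Leading d a p → Leading d (ℤ.- a) (-ₚ p)
leading-neg {d} p l .coeff-at = ≡.trans (coeff--ₚ p d) (≡.cong ℤ.-_ (coeff-at l))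
leading-neg p l .coeff-above k d<k = ≡.trans (coeff--ₚ p k) (≡.cong ℤ.-_ (coeff-above l k d<k))

leading-* : ∀ {d e a b} p q → Leading d a p → Leading e b q → Leading (d ℕ.+ e) (a ℤ.* b) (p *ₚ q)
leading-* {b = b} [] q l m .coeff-at = ≡.sym (≡.trans (≡.cong (ℤ._* b) (≡.sym (coeff-at l))) (ℤ.*-zeroˡ b))
leading-* [] q l m .coeff-above k _ = ≡.refl
-- The bound 0 does not make the list `p` empty: it may still consist of zeros.
leading-* {zero} {e} {a} {b} (a₀ ∷ p) q l m = leading
  (≡.trans (constant e) (≡.cong₂ ℤ._*_ (coeff-at l) (coeff-at m)))
  (λ k e<k → ≡.trans (constant k) (≡.trans (≡.cong (a₀ ℤ.*_) (coeff-above m k e<k)) (ℤ.*-zeroʳ a₀)))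
  where
  p≃[] : p ≃ []
  p≃[] = pointwise λ k → coeff-above l (suc k) (s≤s z≤n)

  constant : ∀ k → coeff ((a₀ ∷ p) *ₚ q) k ≡ a₀ ℤ.* coeff q k
  constant k = ≡.trans (coeff-∷* a₀ p q k) (≡.trans
    (≡.cong (λ c → a₀ ℤ.* coeff q k ℤ.+ c) (_≃_.at (≃-trans (∷-cong (*ₚ-congʳ q p≃[])) 0∷[]) k))
    (ℤ.+-identityʳ _))
-- The summand a₀ q has degree at most e, below d + 1 + e, so the top coefficient is that of the
-- shifted product of `p` and `q`.
leading-* {suc d} {e} {a} {b} (a₀ ∷ p) q l m = leading
  (≡.trans (coeff-∷* a₀ p q (suc (d ℕ.+ e))) (≡.trans
    (≡.cong₂ (λ c f → a₀ ℤ.* c ℤ.+ f) (coeff-above m _ (s≤s (ℕ.m≤n+m e d))) (coeff-at pq))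
    (vanish (a ℤ.* b))))
  above
  where
  pq : Leading (d ℕ.+ e) (a ℤ.* b) (p *ₚ q)
  pq = leading-* p q (leading (coeff-at l) (λ k d<k → coeff-above l (suc k) (s≤s d<k))) m

  vanish : ∀ c → a₀ ℤ.* 0ℤ ℤ.+ c ≡ c
  vanish c = ≡.trans (≡.cong (ℤ._+ c) (ℤ.*-zeroʳ a₀)) (ℤ.+-identityˡ c)

  above : ∀ k → suc d ℕ.+ e ℕ.< k → coeff ((a₀ ∷ p) *ₚ q) k ≡ 0ℤ
  above (suc k) (s≤s d+e<k) = ≡.trans (coeff-∷* a₀ p q (suc k)) (≡.trans
    (≡.cong₂ (λ c f → a₀ ℤ.* c ℤ.+ f)
      (coeff-above m (suc k) (ℕ.≤-trans (s≤s (ℕ.m≤n+m e d)) (ℕ.m≤n⇒m≤1+n d+e<k)))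
      (coeff-above pq k d+e<k))
    (vanish 0ℤ))

-- f = c x^k + lower powers of x, as a Laurent series at infinity.
record Degree (k : ℕ) (c : ℤ) (f : RatFun) : Set where
  constructor degree-of
  field
    {d}         : ℕ
    den-leading : Leading d 1ℤ (den f)
    num-leading : Leading (d ℕ.+ k) c (num f)

leading-[] : ∀ d → Leading d 0ℤ []
leading-[] d = leading ≡.refl (λ _ _ → ≡.refl)

leading-const : ∀ c → Leading 0 c (c ∷ [])
leading-const c = leading ≡.refl λ { (suc k) _ → ≡.refl }

degree-0 : ∀ {k} → Degree k 0ℤ (RawRing.0# ℚ⟨x⟩)
degree-0 = degree-of (leading-const 1ℤ) (leading-[] _)

degree-1 : Degree 0 1ℤ 1#
degree-1 = degree-of (leading-const 1ℤ) (leading-const 1ℤ)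

degree-x : Degree 1 1ℤ x
degree-x = degree-of (leading-const 1ℤ) (leading ≡.refl λ { (suc zero) (s≤s ()) ; (suc (suc k)) _ → ≡.refl })

-- Reads a function of order xᵏ one power higher, where its coefficient is 0. In this form bounded
-- terms can be added to x + O(1) without affecting its leading coefficient.
degree-suc : ∀ {k c f} → Degree k c f → Degree (suc k) 0ℤ f
degree-suc {k} (degree-of {d} den-l num-l) = degree-of den-l (leading-cast (≡.sym (ℕ.+-suc d k))
  (leading (coeff-above num-l _ ℕ.≤-refl) (λ m d+k<m → coeff-above num-l m (ℕ.<-trans ℕ.≤-refl d+k<m))))

degree-⊕ : ∀ {k a b f g} → Degree k a f → Degree k b g → Degree k (a ℤ.+ b) (f ⊕ g)
degree-⊕ {k} {a} {b} {f} {g} (degree-of {d} den-f num-f) (degree-of {e} den-g num-g) = degree-of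
  (leading-* (den f) (den g) den-f den-g)
  (≡.subst (λ c → Leading _ c _) (≡.cong₂ ℤ._+_ (ℤ.*-identityʳ a) (ℤ.*-identityʳ b))
    (leading-+ (num f *ₚ den g) (num g *ₚ den f)
      (leading-cast (xy∙z≈xz∙y d k e) (leading-* (num f) (den g) num-f den-g))
      (leading-cast (≡.trans (ℕ.+-comm (e ℕ.+ k) d) (≡.sym (ℕ.+-assoc d e k)))
        (leading-* (num g) (den f) num-g den-f))))

degree-* : ∀ {k l a b f g} → Degree k a f → Degree l b g → Degree (k ℕ.+ l) (a ℤ.* b) (f * g)
degree-* {k} {l} {f = f} {g} (degree-of {d} den-f num-f) (degree-of {e} den-g num-g) = degree-of
  (leading-* (den f) (den g) den-f den-g)
  (leading-cast (interchange d k e l) (leading-* (num f) (num g) num-f num-g))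

degree-neg : ∀ {k a f} → Degree k a f → Degree k (ℤ.- a) (- f)
degree-neg {f = f} (degree-of den-f num-f) = degree-of den-f (leading-neg (num f) num-f)

degree-sum : ∀ {k n} {a : Fin n → ℤ} {f : Fin n → RatFun} →
  (∀ i → Degree k (a i) (f i)) → Degree k (sumℤ a) (sum f)
degree-sum {n = zero}  h = degree-0
degree-sum {n = suc n} h = degree-⊕ (h zero) (degree-sum (h ∘ suc))

degree-^ : ∀ {a f} → Degree 0 a f → ∀ m → Degree 0 (a ^ℤ m) (f ^ m)
degree-^ h zero    = degree-1
degree-^ h (suc m) = degree-* h (degree-^ h m)

-- The coefficients of the top powers of x multiply and add as the functions do, so the coefficient
-- of xⁿ in det M is the determinant of the coefficients of x in the entries.
degree-det : ∀ {n} {C : Mℤ.Matrix n n} {M : Matrix n n} →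
  (∀ i j → Degree 1 (C i j) (M i j)) → Degree n (Mℤ.det C) (det M)
degree-det {zero}  h = degree-1
degree-det {suc n} h = degree-sum λ j →
  degree-* (degree-^ (degree-neg degree-1) (toℕ j))
    (degree-* (h zero j) (degree-det λ i k → h (suc i) (punchIn j k)))

-- Functions that are bounded at infinity, and pencils with bounded perturbations

Bounded : RatFun → Set
Bounded f = ∃[ c ] Degree 0 c f

bounded-⊕ : ∀ {f g} → Bounded f → Bounded g → Bounded (f ⊕ g)
bounded-⊕ (_ , h) (_ , k) = _ , degree-⊕ h k

bounded-* : ∀ {f g} → Bounded f → Bounded g → Bounded (f * g)
bounded-* (_ , h) (_ , k) = _ , degree-* h k

bounded-neg : ∀ {f} → Bounded f → Bounded (- f)
bounded-neg (_ , h) = _ , degree-neg h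

bounded-if : ∀ b {f} → Bounded f → Bounded (if b then f else RawRing.0# ℚ⟨x⟩)
bounded-if true  h = h
bounded-if false _ = _ , degree-0

bounded-1 : Bounded 1#
bounded-1 = _ , degree-1

bounded-ι : ∀ n → Bounded (ι n)
bounded-ι zero    = _ , degree-0
bounded-ι (suc n) = bounded-⊕ bounded-1 (bounded-ι n)

bounded-diag : ∀ {n} {d : Fin n → RatFun} → (∀ i → Bounded (d i)) → ∀ i j → Bounded (diag d i j)
bounded-diag h i j = bounded-if (does (i Fin.≟ j)) (h i)

bounded-⊗ : ∀ {m n p} {M : Matrix m n} {N : Matrix n p} →
  (∀ i j → Bounded (M i j)) → (∀ i j → Bounded (N i j)) → ∀ i j → Bounded ((M ⊗ N) i j)
bounded-⊗ h k i j = _ , degree-sum λ l → proj₂ (bounded-* (h i l) (k l j))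

bounded-A : ∀ {n} (G : Graph (Fin n)) i j → Bounded (A G i j)
bounded-A G i j = bounded-if (does (Graph.E? G i j)) bounded-1

bounded-D : ∀ {n} (G : Graph (Fin n)) i j → Bounded (D G i j)
bounded-D G = bounded-diag λ i → bounded-ι (degree G i)

bounded-Q : ∀ {n} (G : Graph (Fin n)) i j → Bounded (Q G i j)
bounded-Q G i j = bounded-⊕ (bounded-D G i j) (bounded-A G i j)

Monic₁ : RatFun → Set
Monic₁ = Degree 1 1ℤ

monic₁-⊕ : ∀ {f g} → Monic₁ f → Bounded g → Monic₁ (f ⊕ g)
monic₁-⊕ h (_ , k) = degree-⊕ h (degree-suc k)

-- Whatever the bounded `N` is, the coefficients of x form the integer identity matrix, so
-- `degree-det` produces the leading coefficient det I = 1.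
degree-•I⊞ : ∀ {n y} {N : Matrix n n} → Monic₁ y → (∀ i j → Bounded (N i j)) →
  ∀ i j → Degree 1 (Mℤ.I i j) ((y • I ⊞ N) i j)
degree-•I⊞ h b i j with does (i Fin.≟ j)
... | true  = monic₁-⊕ (degree-* h degree-1) (b i j)
... | false = degree-⊕ (degree-* h degree-0) (degree-suc (proj₂ (b i j)))

num≉0 : ∀ {k f} → Degree k 1ℤ f → NonZeroₚ (num f)
num≉0 (degree-of _ num-f) num≈0 = contradiction (≡.trans (≡.sym (coeff-at num-f)) (num≈0 _)) λ ()

reciprocal : ∀ {k} f → Degree k 1ℤ f → RatFun
reciprocal f h = den f / num f ⟨ num≉0 h ⟩

*-reciprocal : ∀ {k} f (h : Degree k 1ℤ f) → f * reciprocal f h ≈ 1#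
*-reciprocal f h = _≃_.at (P.trans (P.*-identityʳ (num f *ₚ den f))
  (P.trans (*ₚ-comm (num f) (den f)) (P.sym (*ₚ-identityˡ (den f *ₚ num f)))))
  where module P = CommutativeRing polynomialRing

-- The reciprocal of x + O(1) is O(1/x), hence the constant 0. The new denominator, the numerator of
-- `f`, is monic of degree d + 1, while the new numerator has degree d and so vanishes at d + 1.
bounded-reciprocal : ∀ {f} (h : Monic₁ f) → Bounded (reciprocal f h)
bounded-reciprocal h@(degree-of {d} den-f num-f) = 0ℤ , degree-of num-f
  (leading (coeff-above den-f _ (d<d+1+0 d)) (λ k d+1+0<k → coeff-above den-f k (ℕ.<-trans (d<d+1+0 d) d+1+0<k)))
  where
  d<d+1+0 : ∀ d → d ℕ.< d ℕ.+ 1 ℕ.+ 0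
  d<d+1+0 d = ℕ.≤-reflexive (≡.trans (ℕ.+-comm 1 d) (≡.sym (ℕ.+-identityʳ (d ℕ.+ 1))))

private
  module F where
    open CommutativeRing rationalFunctionField public
    open MatrixAlgebra rationalFunctionField public
    open RowOperations rationalFunctionField public
    open GraphMatrices rationalFunctionField public
    open JoinCharacteristicPolynomials rationalFunctionField public

-- Serves Y, where `N` is constant, and Z, where `N` depends on x itself: of its entries only the
-- behaviour at infinity matters.
pencil-invertible : ∀ {n y} {N : Matrix n n} → Monic₁ y → (∀ i j → Bounded (N i j)) →
  F.Symmetricᴹ N → Invertible (y • I ⊟ N)
pencil-invertible {n} {y} {N} h b N-sym =
  F.unit-det⇒invertible {M = y • I ⊟ N} {u = reciprocal (det (y • I ⊟ N)) det-monic} symmetric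
    (*-reciprocal (det (y • I ⊟ N)) det-monic)
  where
  det-monic : Degree n 1ℤ (det (y • I ⊟ N))
  det-monic = ≡.subst (λ c → Degree n c (det (y • I ⊟ N))) (MatrixAlgebra.det-I integerRing n)
    (degree-det (degree-•I⊞ h (λ i j → bounded-neg (b i j))))

  symmetric : F.Symmetricᴹ (y • I ⊟ N)
  symmetric i j = F.+-cong {y * I i j} {y * I j i} { - N i j} { - N j i}
    (F.reflexive (≡.cong (y *_) (F.diag-sym (λ _ → 1#) i j))) (F.-‿cong {N i j} {N j i} (N-sym i j))

-- X is handled separately, since its explicit inverse shows that A X⁻¹ A is bounded, which the
-- invertibility of Z relies on. `N` is added rather than subtracted because both signs occur: it is
-- `D G₁` for the NNS join and its negative for the NS join.
module DiagonalPencil {n y} {N : Matrix n n} (h : Monic₁ y) (b : ∀ i j → Bounded (N i j))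
  (N-diagonal : ∀ {i j} → i ≢ j → N i j ≈ F.0#) where

  entry-monic : ∀ i → Monic₁ ((y • I ⊞ N) i i)
  entry-monic i = ≡.subst (λ c → Degree 1 c ((y • I ⊞ N) i i))
    (MatrixAlgebra.diag-≡ integerRing (λ _ → 1ℤ) i) (degree-•I⊞ h b i i)

  entry⁻¹ : Fin n → RatFun
  entry⁻¹ i = reciprocal ((y • I ⊞ N) i i) (entry-monic i)

  off-diagonal : ∀ {i j} → i ≢ j → (y • I ⊞ N) i j ≈ F.0#
  off-diagonal {i} {j} i≢j = F.trans {(y • I ⊞ N) i j} {F.0# ⊕ F.0#} {F.0#}
    (F.+-cong {y * I i j} {F.0#} {N i j} {F.0#}
      (F.trans {y * I i j} {y * F.0#} {F.0#}
        (F.reflexive (≡.cong (y *_) (F.diag-≢ (λ _ → 1#) i≢j))) (F.zeroʳ y))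
      (N-diagonal i≢j))
    (F.+-identityʳ F.0#)

  invertible : Invertible (y • I ⊞ N)
  invertible = F.diagonal-invertible (y • I ⊞ N) entry⁻¹
    (λ i → *-reciprocal ((y • I ⊞ N) i i) (entry-monic i)) (λ {i} {j} → off-diagonal {i} {j})

  inverse-bounded : ∀ i j → Bounded ((invertible ⁻¹) i j)
  inverse-bounded = bounded-diag λ i → bounded-reciprocal (entry-monic i)

  inverse-symmetric : F.Symmetricᴹ (invertible ⁻¹)
  inverse-symmetric i j = F.reflexive (F.diag-sym entry⁻¹ i j)

  congruence-bounded : ∀ (G : Graph (Fin n)) i j → Bounded ((A G ⊗ invertible ⁻¹ ⊗ A G) i j)
  congruence-bounded G = bounded-⊗ (bounded-⊗ (bounded-A G) inverse-bounded) (bounded-A G)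

  congruence-symmetric : ∀ (G : Graph (Fin n)) → F.Symmetricᴹ (A G ⊗ invertible ⁻¹ ⊗ A G)
  congruence-symmetric G = F.⊗⊗-symmetric {A = A G} {B = invertible ⁻¹}
    (λ i j → F.reflexive (F.A-symmetric G i j)) inverse-symmetric

D-symmetric : ∀ {n} (G : Graph (Fin n)) → F.Symmetricᴹ (D G)
D-symmetric G i j = F.reflexive (F.diag-sym (λ i → ι (degree G i)) i j)

Q-symmetric : ∀ {n} (G : Graph (Fin n)) → F.Symmetricᴹ (Q G)
Q-symmetric G i j = F.reflexive (≡.cong₂ _⊕_ (F.diag-sym (λ i → ι (degree G i)) i j) (F.A-symmetric G i j))

⊞-symmetric : ∀ {n} {M N : Matrix n n} → F.Symmetricᴹ M → F.Symmetricᴹ N → F.Symmetricᴹ (M ⊞ N)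
⊞-symmetric {M = M} {N} M-sym N-sym i j = F.+-cong {M i j} {M j i} {N i j} {N j i} (M-sym i j) (N-sym i j)

⊟-symmetric : ∀ {n} {M N : Matrix n n} → F.Symmetricᴹ M → F.Symmetricᴹ N → F.Symmetricᴹ (M ⊟ N)
⊟-symmetric {M = M} {N} M-sym N-sym = ⊞-symmetric {M = M} {λ i j → - N i j} M-sym
  (λ i j → F.-‿cong {N i j} {N j i} (N-sym i j))

D-diagonal : ∀ {n} (G : Graph (Fin n)) {i j} → i ≢ j → D G i j ≡ F.0#
D-diagonal G = F.diag-≢ (λ i → ι (degree G i))

monic-x⊝ι : ∀ n → Monic₁ (x ⊝ ι n)
monic-x⊝ι n = monic₁-⊕ degree-x (bounded-neg (bounded-ι n))

-- Invertibility of X, Y and Z for the two joins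

module _ (n₁ n₂ : ℕ) (G₁ : Graph (Fin n₁)) (G₂ : Graph (Fin n₂)) where

  Y-invertible : Invertible ((x ⊝ ι n₁) • I ⊟ Q G₂)
  Y-invertible = pencil-invertible (monic-x⊝ι n₁) (bounded-Q G₂) (Q-symmetric G₂)

  module XNNS = DiagonalPencil {y = x ⊝ ι n₁ ⊕ 1#} {N = D G₁}
    (monic₁-⊕ (monic-x⊝ι n₁) bounded-1) (bounded-D G₁) (λ i≢j → F.reflexive (D-diagonal G₁ i≢j))

  ZNNS-invertible : Invertible ((x ⊝ ι n₁ ⊝ ι n₂ ⊕ 1#) • I
    ⊟ (Q G₁ ⊟ D G₁ ⊞ A (complement G₁) ⊗ XNNS.invertible ⁻¹ ⊗ A (complement G₁)))
  ZNNS-invertible = pencil-invertible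
    (monic₁-⊕ (monic₁-⊕ (monic-x⊝ι n₁) (bounded-neg (bounded-ι n₂))) bounded-1)
    (λ i j → bounded-⊕ (bounded-⊕ (bounded-Q G₁ i j) (bounded-neg (bounded-D G₁ i j)))
      (XNNS.congruence-bounded (complement G₁) i j))
    (⊞-symmetric {M = Q G₁ ⊟ D G₁} {A (complement G₁) ⊗ XNNS.invertible ⁻¹ ⊗ A (complement G₁)}
      (⊟-symmetric {M = Q G₁} {D G₁} (Q-symmetric G₁) (D-symmetric G₁)) (XNNS.congruence-symmetric (complement G₁)))

  module XNS = DiagonalPencil {y = x} {N = λ i j → - D G₁ i j}
    degree-x (λ i j → bounded-neg (bounded-D G₁ i j)) (λ i≢j → F.reflexive (≡.cong -_ (D-diagonal G₁ i≢j)))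

  ZNS-invertible : Invertible ((x ⊝ ι n₂) • I ⊟ (Q G₁ ⊞ D G₁ ⊞ A G₁ ⊗ XNS.invertible ⁻¹ ⊗ A G₁))
  ZNS-invertible = pencil-invertible (monic-x⊝ι n₂)
    (λ i j → bounded-⊕ (bounded-⊕ (bounded-Q G₁ i j) (bounded-D G₁ i j)) (XNS.congruence-bounded G₁ i j))
    (⊞-symmetric {M = Q G₁ ⊞ D G₁} {A G₁ ⊗ XNS.invertible ⁻¹ ⊗ A G₁}
      (⊞-symmetric {M = Q G₁} {D G₁} (Q-symmetric G₁) (D-symmetric G₁)) (XNS.congruence-symmetric G₁))

theorem4p3 :
  ∀ (n₁ n₂ : ℕ) (G₁ : Graph (Fin n₁)) (G₂ : Graph (Fin n₂)) →
  -- (a)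
  (Σ[ X ∈ Invertible ((x ⊝ ι n₁ ⊕ 1#) • I ⊞ D G₁) ]
   Σ[ Y ∈ Invertible ((x ⊝ ι n₁) • I ⊟ Q G₂) ]
   Σ[ Z ∈ Invertible ((x ⊝ ι n₁ ⊝ ι n₂ ⊕ 1#) • I
            ⊟ (Q G₁ ⊟ D G₁ ⊞ A (complement G₁) ⊗ X ⁻¹ ⊗ A (complement G₁))) ]
     charPoly (Q (NNSJoin G₁ G₂))
       ≈ det ((x ⊝ ι n₁) • I ⊟ Q G₂)
       * det ((x ⊝ ι n₁ ⊕ 1#) • I ⊞ D G₁)
       * det ((x ⊝ ι n₁ ⊝ ι n₂ ⊕ 1#) • I ⊟ Q G₁ ⊞ D G₁
               ⊟ A (complement G₁) ⊗ X ⁻¹ ⊗ A (complement G₁))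
       * (1# ⊝ Γ (Q G₂) (x ⊝ ι n₁) Y
             * Γ (Q G₁ ⊟ D G₁ ⊞ A (complement G₁) ⊗ X ⁻¹ ⊗ A (complement G₁))
                 (x ⊝ ι n₁ ⊝ ι n₂ ⊕ 1#) Z))
  ×
  -- (b)
  (Σ[ X ∈ Invertible (x • I ⊟ D G₁) ]
   Σ[ Y ∈ Invertible ((x ⊝ ι n₁) • I ⊟ Q G₂) ]
   Σ[ Z ∈ Invertible ((x ⊝ ι n₂) • I
            ⊟ (Q G₁ ⊞ D G₁ ⊞ A G₁ ⊗ X ⁻¹ ⊗ A G₁)) ]
     charPoly (Q (NSJoin G₁ G₂))
       ≈ det ((x ⊝ ι n₁) • I ⊟ Q G₂)
       * det (x • I ⊟ D G₁)
       * det ((x ⊝ ι n₂) • I ⊟ Q G₁ ⊟ D G₁ ⊟ A G₁ ⊗ X ⁻¹ ⊗ A G₁)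
       * (1# ⊝ Γ (Q G₂) (x ⊝ ι n₁) Y
             * Γ (Q G₁ ⊞ D G₁ ⊞ A G₁ ⊗ X ⁻¹ ⊗ A G₁) (x ⊝ ι n₂) Z))
theorem4p3 n₁ n₂ G₁ G₂ =
  (XNNS.invertible n₁ n₂ G₁ G₂ , Y-invertible n₁ n₂ G₁ G₂ , ZNNS-invertible n₁ n₂ G₁ G₂ ,
    F.det-NNSJoin x G₁ G₂ (XNNS.invertible n₁ n₂ G₁ G₂) (Y-invertible n₁ n₂ G₁ G₂) (ZNNS-invertible n₁ n₂ G₁ G₂)) ,
  (XNS.invertible n₁ n₂ G₁ G₂ , Y-invertible n₁ n₂ G₁ G₂ , ZNS-invertible n₁ n₂ G₁ G₂ ,
    F.det-NSJoin x G₁ G₂ (XNS.invertible n₁ n₂ G₁ G₂) (Y-invertible n₁ n₂ G₁ G₂) (ZNS-invertible n₁ n₂ G₁ G₂))
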